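{- Let $n$ be an odd integer and let $C_n$ be the cycle on $n$ vertices. Then $\widetilde{r}_{ind}(C_n) \le \widetilde{r}_{ind}(C_{2n})+n \le 735n-27$.
   Context: The online Ramsey game for a target graph $H$ is played between Builder and Painter on an infinite set of vertices, initially with no edges. In each round Builder adds a new edge between two vertices (forming the background graph $G$), and Painter immediately colors that edge red or blue. The induced online Ramsey number $\widetilde{r}_{ind}(H)$ is the minimum number $m$ such that Builder has a strategy guaranteeing that, against any Painter strategy, after at most $m$ rounds there is a monochromatic induced copy of $H$ in $G$, i.e. a vertex set $S$ such that the subgraph of $G$ induced on $S$ is isomorphic to $H$ and all its edges have the same color ($\infty$ if no such strategy exists). -}

module Defs where

open import Data.Nat using (ℕ; zero; suc; _+_; _*_)
open import Data.Fin using (Fin; toℕ)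
open import Data.Product using (Σ; ∃; _×_; _,_)
open import Data.Sum using (_⊎_)
open import Data.List using (List; []; _∷_)
open import Data.List.Relation.Unary.Any using (Any)
open import Relation.Binary.PropositionalEquality using (_≡_; _≢_)
open import Relation.Nullary using (¬_)
open import Function.Definitions using (Injective)

data Colour : Set where
  red blue : Colour

-- A board: the background graph G built so far, on vertex set ℕ (infinite),
-- as a list of coloured edges (u , v , c); the edge {u,v} has colour c.
Board : Set
Board = List (ℕ × ℕ × Colour)

Adj : Board → ℕ → ℕ → Set
Adj B u v = Any (λ { (a , b , _) → (a ≡ u × b ≡ v) ⊎ (a ≡ v × b ≡ u) }) B

AdjC : Board → Colour → ℕ → ℕ → Set
AdjC B c u v = Any (λ { (a , b , d) → d ≡ c × ((a ≡ u × b ≡ v) ⊎ (a ≡ v × b ≡ u)) }) B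

Graph : ℕ → Set₁
Graph k = Fin k → Fin k → Set

MonoInducedCopy : ∀ {k} → Graph k → Board → Set
MonoInducedCopy {k} H B =
  Σ Colour λ c → Σ (Fin k → ℕ) λ f →
    Injective _≡_ _≡_ f
    × (∀ i j → H i j → AdjC B c (f i) (f j))
    × (∀ i j → Adj B (f i) (f j) → H i j)

-- Builder, from board B, can force a monochromatic induced copy of H within
-- at most m further rounds, whatever Painter does.  In each round Builder adds
-- a new edge {u,v} (u ≠ v, not already present) and Painter colours it.
data Wins {k} (H : Graph k) : ℕ → Board → Set where
  done : ∀ {m B} → MonoInducedCopy H B → Wins H m B
  step : ∀ {m B} (u v : ℕ) → u ≢ v → ¬ Adj B u v →
         (∀ c → Wins H m ((u , v , c) ∷ B)) → Wins H (suc m) B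

-- r̃_ind(H) ≤ m  (with r̃_ind(H) = ∞ if Builder has no winning strategy).
IndOnlineRamseyLE : ∀ {k} → Graph k → ℕ → Set
IndOnlineRamseyLE H m = Wins H m []

CycStep : ∀ {k} → Fin k → Fin k → Set
CycStep {k} i j = (toℕ j ≡ suc (toℕ i)) ⊎ (suc (toℕ i) ≡ k × toℕ j ≡ 0)

Cycle : (k : ℕ) → Graph k
Cycle k i j = CycStep i j ⊎ CycStep j i

Odd : ℕ → Set
Odd n = ∃ λ t → n ≡ suc (2 * t)

{-# OPTIONS --safe #-}

-- First bound, n = 2t + 1.  Round a monochromatic induced C_2n Builder joins a vertex to the one n + 1 places
-- further on, then proceeds from there; as n is odd, n such chords form an n-cycle through every other vertex.
-- A chord of the old colour closes an induced C_n with the arc on its other side; if there is none, the chords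
-- themselves are an induced C_n of the other colour.
--
-- Second bound: Builder forces C_ℓ for ℓ = 2n = 4t + 2; c is one of the two colours, flip c the other.
--
-- Paths.  Builder draws many disjoint edges, keeps those of the majority colour c and maintains an induced c-path
-- R and an induced (flip c)-path Q, not adjacent to each other, with tips v and q.  For an unused edge x₁x₂ he joins
-- q x₁, then q v, then v x₂, stopping as soon as one of the paths can be extended at a bounded loss for the other;
-- 4|R| + 5|Q| always grows.
--
-- Legs.  Let p be a long induced c-path.  A c-chord from i to i + ℓ - 1 closes a c-coloured C_ℓ, so Builder may
-- assume that all chords of displacement α = ℓ - 1 come out in the other colour.  He joins i to i + α + 3.  If that chord
-- is not c-coloured, stepping back by α leads to i + 3; if it is, then the chord of displacement 2α + 2 cannot be
-- c-coloured, and stepping back by α twice leads to i + 2.  Repeating this gives a (flip c)-path which is induced since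
-- all chords have displacement α, α + 3 or 2α + 2.
--
-- Spider.  If a vertex were joined in colour c to both ends of a c-path on ℓ - 1 vertices, a c-coloured C_ℓ would arise;
-- hence a vertex can always be joined in the other colour to one of two given vertices at distance ℓ - 2 on p.
-- In this way a centre z gets three legs of 2t vertices, and the three tips are attached to the ends of
-- one further arc.  Two of them are attached to the same end, and with z they lie on a (flip c)-coloured C_ℓ.

module Submission where

open import Defs
open import Data.Nat using (ℕ; zero; suc; _+_; _*_; _∸_; _≤_; _<_; z≤n; s≤s; _≟_; _≤?_; NonZero; >-nonZero)
open import Data.Nat.Properties
open import Data.Nat.DivMod
open import Data.Nat.Tactic.RingSolver using (solve-∀)
open import Data.Fin using (Fin; zero; suc; toℕ; fromℕ<)
open import Data.Fin.Properties using (toℕ<n; toℕ-injective; toℕ-fromℕ<; fromℕ<-cong; fromℕ<-injective)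
open import Data.Product using (∃; ∃₂; _×_; _,_; proj₁; proj₂)
open import Data.Sum using (_⊎_; inj₁; inj₂; swap; [_,_]′)
open import Data.List using (List; []; _∷_; _++_; [_]; length; map; reverse; _ʳ++_; drop)
open import Data.List.Properties
  using (reverse-++; ʳ++-defn; reverse-involutive; unfold-reverse; ++-assoc; length-++; length-reverse; length-map; map-++)
open import Data.List.Membership.Propositional using (_∈_)
open import Data.List.Relation.Unary.Any as Any using (here; there; any?)
open import Data.List.Relation.Unary.All as All using (All; []; _∷_)
import Data.List.Relation.Unary.All.Properties as All
open import Data.List.Relation.Unary.AllPairs using (AllPairs; []; _∷_)
open import Data.Empty using (⊥; ⊥-elim)
open import Relation.Nullary using (¬_; Dec; yes; no)
open import Relation.Nullary.Decidable using (_×-dec_; _⊎-dec_)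
open import Relation.Binary.Definitions using (tri<; tri≈; tri>)
open import Relation.Binary.PropositionalEquality
  using (_≡_; _≢_; refl; sym; trans; cong; cong₂; subst; subst₂; ≢-sym)
open import Function using (_∘_; id)

private variable
  k m : ℕ
  A A′ : Set
  H : Graph k
  B B′ B″ : Board
  c : Colour
  W W′ : ℕ → ℕ → Set

-- Boards and cycles

flip : Colour → Colour
flip red = blue
flip blue = red

same-or-flipped : ∀ c d → d ≡ c ⊎ d ≡ flip c
same-or-flipped red red = inj₁ refl
same-or-flipped red blue = inj₂ refl
same-or-flipped blue red = inj₂ refl
same-or-flipped blue blue = inj₁ refl

SameEdge : ℕ → ℕ → ℕ → ℕ → Set
SameEdge a b u v = (a ≡ u × b ≡ v) ⊎ (a ≡ v × b ≡ u)

Adj-sym : ∀ {u v} → Adj B u v → Adj B v u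
Adj-sym = Any.map swap

Adj⇒AdjC : ∀ {u v} → Adj B u v → ∃ λ d → AdjC B d u v
Adj⇒AdjC {(_ , _ , d) ∷ _} (here e) = d , here (refl , e)
Adj⇒AdjC {_ ∷ _} (there p) with Adj⇒AdjC p
... | d , q = d , there q

adj? : ∀ B u v → Dec (Adj B u v)
adj? B u v = any? (λ (a , b , _) → (a ≟ u ×-dec b ≟ v) ⊎-dec (a ≟ v ×-dec b ≟ u)) B

-- Distinctness travels with adjacency and with non-adjacency, so that the injectivity of a copy can
-- be read off from both.
Edge : Board → Colour → ℕ → ℕ → Set
Edge B c x y = x ≢ y × AdjC B c x y

NonEdge : Board → ℕ → ℕ → Set
NonEdge B x y = x ≢ y × ¬ Adj B x y

Edge-sym : ∀ {x y} → Edge B c x y → Edge B c y x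
Edge-sym (n , e) = ≢-sym n , Any.map (λ (d , s) → d , swap s) e

NonEdge-sym : ∀ {x y} → NonEdge B x y → NonEdge B y x
NonEdge-sym (n , e) = ≢-sym n , e ∘ Adj-sym

-- `W` bounds the pairs that may have become adjacent, so non-adjacency outside `W` survives; being
-- only a bound, it also covers a skipped round. Loops are recorded separately because `W` may hold
-- of equal vertices.
record Grows (W : ℕ → ℕ → Set) (B B′ : Board) : Set where
  constructor grows
  field
    keep : ∀ {c x y} → AdjC B c x y → AdjC B′ c x y
    new  : ∀ {x y} → Adj B′ x y → Adj B x y ⊎ W x y
    loop : ∀ {x} → Adj B′ x x → Adj B x x
open Grows public


grows-refl : Grows W B B
grows-refl = grows id inj₁ id

grows-trans : Grows W B B′ → Grows W B′ B″ → Grows W B B″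
grows-trans g h = grows (keep h ∘ keep g) ([ new g , inj₂ ]′ ∘ new h) (loop g ∘ loop h)

grows-map : (∀ {x y} → W x y → W′ x y) → Grows W B B′ → Grows W′ B B′
grows-map f g = grows (keep g) ([ inj₁ , inj₂ ∘ f ]′ ∘ new g) (loop g)

Edge-grows : ∀ {x y} → Grows W B B′ → Edge B c x y → Edge B′ c x y
Edge-grows g (n , e) = n , keep g e

NonEdge-grows : ∀ {x y} → Grows W B B′ → ¬ W x y → NonEdge B x y → NonEdge B′ x y
NonEdge-grows g w (n , e) = n , [ e , w ]′ ∘ new g

Wins-mono : ∀ {m m′} → m ≤ m′ → Wins H m B → Wins H m′ B
Wins-mono _ (done x) = done x
Wins-mono (s≤s p) (step u v n a w) = step u v n a (λ c → Wins-mono p (w c))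

-- Builder may also "join" vertices that are already adjacent; the round is then skipped.
join : ∀ {x y} → x ≢ y →
  (∀ {B′} d → Grows (SameEdge x y) B B′ → Edge B′ d x y → Wins H m B′) → Wins H (suc m) B
join {B = B} {x = x} {y} n w with adj? B x y
... | yes a = let d , e = Adj⇒AdjC a in Wins-mono (n≤1+n _) (w d grows-refl (n , e))
... | no ¬a = step x y n ¬a λ c →
  w c (grows there (λ { (here e) → inj₂ e ; (there e) → inj₁ e }) no-loop) (n , here (refl , inj₁ (refl , refl)))
  where
  no-loop : ∀ {c z} → Adj ((x , y , c) ∷ B) z z → Adj B z z
  no-loop (here (inj₁ (refl , q))) = ⊥-elim (n (sym q))
  no-loop (here (inj₂ (refl , q))) = ⊥-elim (n (sym q))
  no-loop (there e) = e

join-either : ∀ c {x y} → x ≢ y →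
  (∀ {B′} → Grows (SameEdge x y) B B′ → Edge B′ c x y → Wins H m B′) →
  (∀ {B′} → Grows (SameEdge x y) B B′ → Edge B′ (flip c) x y → Wins H m B′) → Wins H (suc m) B
join-either c n w₁ w₂ = join n λ d g e → [ (λ { refl → w₁ g e }) , (λ { refl → w₂ g e }) ]′ (same-or-flipped c d)

private
  ring-edges : ∀ m {g : ℕ → ℕ} →
    (∀ i → suc i < m → Edge B c (g i) (g (suc i))) →
    (∀ l → suc l ≡ m → Edge B c (g l) (g 0)) →
    (i j : Fin m) → CycStep i j → AdjC B c (g (toℕ i)) (g (toℕ j))
  ring-edges {B = B} {c} m {g} e z i j (inj₁ p) =
    subst (λ x → AdjC B c (g (toℕ i)) (g x)) (sym p) (proj₂ (e (toℕ i) (subst (_< m) p (toℕ<n j))))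
  ring-edges {B = B} {c} m {g} e z i j (inj₂ (p , q)) =
    subst (λ x → AdjC B c (g (toℕ i)) (g x)) (sym q) (proj₂ (z (toℕ i) p))

-- Adjacency is symmetric, so only pairs `i < j` need inspection; among them a cycle has the
-- successive pairs and the closing pair 0, `m` - 1.
ring⇒copy : ∀ m (g : ℕ → ℕ) →
  (∀ i → suc i < m → Edge B c (g i) (g (suc i))) →
  (∀ l → suc l ≡ m → Edge B c (g l) (g 0)) →
  (∀ i j → i < j → j < m → g i ≢ g j) →
  (∀ i j → i < j → j < m → Adj B (g i) (g j) → j ≡ suc i ⊎ (i ≡ 0 × suc j ≡ m)) →
  (∀ i → i < m → ¬ Adj B (g i) (g i)) →
  MonoInducedCopy (Cycle m) B
ring⇒copy {B = B} {c = c} m g e z inj ind irr = c , g ∘ toℕ , injective , edges , induced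
  where
  injective : ∀ {i j : Fin m} → g (toℕ i) ≡ g (toℕ j) → i ≡ j
  injective {i} {j} p with <-cmp (toℕ i) (toℕ j)
  ... | tri< l _ _ = ⊥-elim (inj _ _ l (toℕ<n j) p)
  ... | tri≈ _ q _ = toℕ-injective q
  ... | tri> _ _ l = ⊥-elim (inj _ _ l (toℕ<n i) (sym p))
  edges : ∀ i j → Cycle m i j → AdjC B c (g (toℕ i)) (g (toℕ j))
  edges i j (inj₁ s) = ring-edges m e z i j s
  edges i j (inj₂ s) = Any.map (λ (d , t) → d , swap t) (ring-edges m e z j i s)
  forward : ∀ i j → toℕ i < toℕ j → Adj B (g (toℕ i)) (g (toℕ j)) → Cycle m i j
  forward i j l a with ind _ _ l (toℕ<n j) a
  ... | inj₁ p = inj₁ (inj₁ p)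
  ... | inj₂ (p , q) = inj₂ (inj₂ (q , p))
  induced : ∀ i j → Adj B (g (toℕ i)) (g (toℕ j)) → Cycle m i j
  induced i j a with <-cmp (toℕ i) (toℕ j)
  ... | tri< l _ _ = forward i j l a
  ... | tri≈ _ q _ = ⊥-elim (irr (toℕ i) (toℕ<n i) (subst (λ x → Adj B (g (toℕ i)) (g x)) (sym q) a))
  ... | tri> _ _ l = swap (forward j i l (Adj-sym a))

Loopless : Board → Set
Loopless B = ∀ x → ¬ Adj B x x

loopless-grows : Grows W B B′ → Loopless B → Loopless B′
loopless-grows g l x = l x ∘ loop g

-- The last condition is phrased by displacement, the form in which chords are known later. Inside
-- the window, displacement `w` occurs only between the two ends.
window⇒copy : ∀ w (p : ℕ → ℕ) o →
  (∀ x → x ≤ w → ¬ Adj B (p (o + x)) (p (o + x))) →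
  (∀ x → x < w → Edge B c (p (o + x)) (p (o + suc x))) →
  Edge B c (p o) (p (o + w)) →
  (∀ x y → x < y → y ≤ w → p (o + x) ≢ p (o + y)) →
  (∀ x y → x < y → y ≤ w → Adj B (p (o + x)) (p (o + y)) → y ≡ suc x ⊎ y ≡ x + w) →
  MonoInducedCopy (Cycle (suc w)) B
window⇒copy {B = B} {c = c} w p o irr e z inj ind = ring⇒copy {B = B} {c = c} (suc w) (λ x → p (o + x))
  (λ i l → e i (≤-pred l))
  (λ { _ refl → Edge-sym {B = B} (subst (λ x → Edge B c (p x) (p (o + w))) (sym (+-identityʳ o)) z) })
  (λ i j l m → inj i j l (≤-pred m)) indu
  (λ i l → irr i (≤-pred l))
  where
  indu : ∀ i j → i < j → j < suc w → Adj B (p (o + i)) (p (o + j)) → j ≡ suc i ⊎ (i ≡ 0 × suc j ≡ suc w)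
  indu i j l m a with ind i j l (≤-pred m) a
  ... | inj₁ q = inj₁ q
  indu zero j l m a | inj₂ q = inj₂ (refl , cong suc q)
  indu (suc i) j l m a | inj₂ q = ⊥-elim (<⇒≱ m (subst (suc w ≤_) (sym q) (s≤s (m≤n+m w i))))

record InducedPath (B : Board) (c : Colour) (g : ℕ → ℕ) (m : ℕ) : Set where
  field
    edge : ∀ i → suc i < m → Edge B c (g i) (g (suc i))
    far  : ∀ i j → suc i < j → j < m → NonEdge B (g i) (g j)
  distinct : ∀ i j → i < j → j < m → g i ≢ g j
  distinct i j l b with m≤n⇒m<n∨m≡n l
  ... | inj₁ l′ = proj₁ (far i j l′ b)
  ... | inj₂ refl = proj₁ (edge i b)
  adjacent : ∀ i j → i < j → j < m → Adj B (g i) (g j) → j ≡ suc i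
  adjacent i j l b a with m≤n⇒m<n∨m≡n l
  ... | inj₁ l′ = ⊥-elim (proj₂ (far i j l′ b) a)
  ... | inj₂ q = sym q
open InducedPath public

InducedPath-shift : ∀ {g m} o k → o + k ≤ m → InducedPath B c g m → InducedPath B c (λ x → g (o + x)) k
InducedPath-shift {B = B} {c = c} {g = g} {m = m} o k l π = record
  { edge = λ i b → subst (λ x → Edge B c (g (o + i)) (g x)) (sym (+-suc o i))
      (edge π (o + i) (subst (_< m) (+-suc o i) (<-≤-trans (+-monoʳ-< o b) l)))
  ; far = λ i j b b′ → far π (o + i) (o + j) (subst (_< o + j) (+-suc o i) (+-monoʳ-< o b))
      (<-≤-trans (+-monoʳ-< o b′) l) }

InducedPath-grows : ∀ {g m} → Grows W B B′ → (∀ i j → i < m → j < m → ¬ W (g i) (g j)) →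
  InducedPath B c g m → InducedPath B′ c g m
InducedPath-grows g w π = record
  { edge = λ i b → Edge-grows g (edge π i b)
  ; far = λ i j b b′ → NonEdge-grows g (w i j (<-trans (<-trans (n<1+n i) b) b′) b′) (far π i j b b′) }

-- `x` becomes vertex 0 of the ring, with the path after it; `1 ≤ l` makes the two ends of the path
-- different.
path⇒copy : ∀ {g x} l → 1 ≤ l → Loopless B → InducedPath B c g (suc l) →
  Edge B c x (g 0) → Edge B c x (g l) →
  (∀ k → suc k < l → NonEdge B x (g (suc k))) →
  MonoInducedCopy (Cycle (suc (suc l))) B
path⇒copy {B = B} {c = c} {g = g} {x = x} (suc m) _ ll π e₀ e₁ n = ring⇒copy {B = B} {c = c} (suc (suc (suc m))) h
  (λ { zero _ → e₀ ; (suc i) l → edge π i (≤-pred l) })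
  (λ { _ refl → Edge-sym {B = B} e₁ })
  (λ { zero (suc j) l b → x≢g j (≤-pred b) ; (suc i) (suc j) l b → distinct π i j (≤-pred l) (≤-pred b) })
  ind (λ i _ → ll (h i))
  where
  h : ℕ → ℕ
  h zero = x
  h (suc i) = g i
  x≢g : ∀ j → j < suc (suc m) → x ≢ g j
  x≢g zero l = proj₁ e₀
  x≢g (suc j) l with m≤n⇒m<n∨m≡n (≤-pred (≤-pred l))
  ... | inj₁ l′ = proj₁ (n j (s≤s l′))
  ... | inj₂ refl = proj₁ e₁
  ind : ∀ i j → i < j → j < suc (suc (suc m)) → Adj B (h i) (h j) →
    j ≡ suc i ⊎ (i ≡ 0 × suc j ≡ suc (suc (suc m)))
  ind zero (suc zero) l b a = inj₁ refl
  ind zero (suc (suc j)) l b a with m≤n⇒m<n∨m≡n (≤-pred (≤-pred (≤-pred b)))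
  ... | inj₁ l′ = ⊥-elim (proj₂ (n j (s≤s l′)) a)
  ... | inj₂ refl = inj₂ (refl , refl)
  ind (suc i) (suc j) l b a = inj₁ (cong suc (adjacent π i j (≤-pred l) (≤-pred b) a))

-- From C_2n to C_n

-- The slack e and the hypothesis l ≤ r reduce a linear inequality to a semiring identity.
≤-by : ∀ {a b l r} e → l ≤ r → b + l ≡ a + e + r → a ≤ b
≤-by {a} {b} {l} {r} e h q = ≤-trans (m≤m+n a e) (+-cancelʳ-≤ l (a + e) b
  (≤-trans (+-monoʳ-≤ (a + e) h) (≤-reflexive (sym q))))

absurd-by : ∀ {A : Set} {l r} e → l ≤ r → l ≡ suc (r + e) → A
absurd-by {l = l} {r} e h q = ⊥-elim (<⇒≱ (subst (r <_) (sym q) (s≤s (m≤m+n r e))) h)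

parity : ∀ s → ∃ λ u → s ≡ 2 * u ⊎ s ≡ suc (2 * u)
parity zero = 0 , inj₁ refl
parity (suc s) with parity s
... | u , inj₁ q = u , inj₂ (cong suc q)
... | u , inj₂ q = suc u , inj₁ (trans (cong suc q) (e u))
  where
  e : ∀ u → suc (suc (2 * u)) ≡ 2 * suc u
  e = solve-∀

<⇒+ : ∀ {i j} → i < j → ∃ λ k → j ≡ i + suc k
<⇒+ {i} l = _ , trans (sym (m+[n∸m]≡n l)) (sym (+-suc i _))

-- A cycle unrolled to a periodic sequence

module Periodic {N : ℕ} (2<N : 2 < N) {B₀ : Board} {c : Colour} (f : Fin N → ℕ)
  (f-injective : ∀ {i j} → f i ≡ f j → i ≡ j)
  (f-edge : ∀ i j → Cycle N i j → AdjC B₀ c (f i) (f j))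
  (f-induced : ∀ i j → Adj B₀ (f i) (f j) → Cycle N i j) where

  instance
    N≢0 : NonZero N
    N≢0 = >-nonZero (<-trans (s≤s z≤n) 2<N)

  ix : ℕ → Fin N
  ix i = fromℕ< (m%n<n i N)

  -- Indexing by all naturals lets displacements be added without reduction; any `N` successive
  -- indices give distinct vertices.
  p : ℕ → ℕ
  p i = f (ix i)

  toℕ-ix : ∀ i → toℕ (ix i) ≡ i % N
  toℕ-ix i = toℕ-fromℕ< (m%n<n i N)

  p-cong : ∀ i j → i % N ≡ j % N → p i ≡ p j
  p-cong i j q = cong f (fromℕ<-cong (i % N) (j % N) q (m%n<n i N) (m%n<n j N))

  p-injective : ∀ i j → p i ≡ p j → i % N ≡ j % N
  p-injective i j q = fromℕ<-injective (i % N) (j % N) (m%n<n i N) (m%n<n j N) (f-injective q)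

  p-shift : ∀ i j e → p i ≡ p j → p (i + e) ≡ p (j + e)
  p-shift i j e q = p-cong (i + e) (j + e) (trans (%-distribˡ-+ i e N)
    (trans (cong (λ x → (x + e % N) % N) (p-injective i j q)) (sym (%-distribˡ-+ j e N))))

  p-periodic : ∀ i k → p (i + k * N) ≡ p i
  p-periodic i k = p-cong (i + k * N) i ([m+kn]%n≡m%n i k N)

  -- Equal vertices have equal residues modulo `N`, so the larger index has the larger quotient and
  -- lies at least `N` further on.
  p-apart : ∀ i j → i < j → j < i + N → p i ≢ p j
  p-apart i j l b q = <⇒≱ b (begin
    i + N                  ≡⟨ cong (_+ N) i≡ ⟩
    r + i / N * N + N      ≡⟨ lem r (i / N * N) N ⟩
    r + suc (i / N) * N    ≤⟨ +-monoʳ-≤ r (*-monoˡ-≤ N k<) ⟩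
    r + j / N * N          ≡⟨ sym j≡ ⟩
    j                      ∎)
    where
    open ≤-Reasoning
    r = i % N
    i≡ : i ≡ r + i / N * N
    i≡ = m≡m%n+[m/n]*n i N
    j≡ : j ≡ r + j / N * N
    j≡ = trans (m≡m%n+[m/n]*n j N) (cong (_+ j / N * N) (sym (p-injective i j q)))
    k< : i / N < j / N
    k< = ≰⇒> λ z → <⇒≱ l (begin
      j              ≡⟨ j≡ ⟩
      r + j / N * N  ≤⟨ +-monoʳ-≤ r (*-monoˡ-≤ N z) ⟩
      r + i / N * N  ≡⟨ sym i≡ ⟩
      i              ∎)
    lem : ∀ a b c → a + b + c ≡ a + (c + b)
    lem = solve-∀

  p-unique : ∀ i x y → i ≤ x → i ≤ y → x < i + N → y < i + N → p x ≡ p y → x ≡ y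
  p-unique i x y ix iy xb yb q with <-cmp x y
  ... | tri< l _ _ = ⊥-elim (p-apart x y l (<-≤-trans yb (+-monoˡ-≤ N ix)) q)
  ... | tri≈ _ e _ = e
  ... | tri> _ _ l = ⊥-elim (p-apart y x l (<-≤-trans xb (+-monoˡ-≤ N iy)) (sym q))

  suc-% : ∀ i → suc i % N ≡ suc (i % N) % N
  suc-% i = trans (%-distribˡ-+ 1 i N) (cong (λ x → (x + i % N) % N) (m<n⇒m%n≡m (<-trans (s≤s (s≤s z≤n)) 2<N)))

  p-step : ∀ i j → CycStep (ix i) (ix j) → p (suc i) ≡ p j
  p-step i j s = p-cong (suc i) j (trans (suc-% i) (go s))
    where
    go : CycStep (ix i) (ix j) → suc (i % N) % N ≡ j % N
    go (inj₁ q) = trans (%-congˡ (trans (cong suc (sym (toℕ-ix i))) (trans (sym q) (toℕ-ix j)))) (m%n%n≡m%n j N)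
    go (inj₂ (q , z)) = trans (%-congˡ (trans (cong suc (sym (toℕ-ix i))) q))
      (trans (n%n≡0 N) (trans (sym z) (toℕ-ix j)))

  p-edge : ∀ i → AdjC B₀ c (p i) (p (suc i))
  p-edge i = f-edge (ix i) (ix (suc i)) (inj₁ (go (m≤n⇒m<n∨m≡n (m%n<n i N))))
    where
    go : suc (i % N) < N ⊎ suc (i % N) ≡ N → CycStep (ix i) (ix (suc i))
    go (inj₁ l) = inj₁ (trans (toℕ-ix (suc i)) (trans (suc-% i) (trans (m<n⇒m%n≡m l) (cong suc (sym (toℕ-ix i))))))
    go (inj₂ q) = inj₂ (trans (cong suc (toℕ-ix i)) q ,
      trans (toℕ-ix (suc i)) (trans (suc-% i) (trans (%-congˡ q) (n%n≡0 N))))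

  -- The neighbours of `p i` appear among the following `N` - 1 indices at the first and the last
  -- place; the last one is the predecessor after a full turn.
  p-adj : ∀ i j → i < j → j < i + N → Adj B₀ (p i) (p j) → j ≡ suc i ⊎ suc j ≡ i + N
  p-adj i j l b a with f-induced (ix i) (ix j) a
  ... | inj₁ s = inj₁ (sym (p-unique (suc i) (suc i) j ≤-refl l
          (s≤s (m<m+n i (<-trans (s≤s z≤n) 2<N))) (<-trans b (n<1+n _)) (p-step i j s)))
  ... | inj₂ s = inj₂ (p-unique (suc i) (suc j) (i + N) (<⇒≤ (s≤s l)) (m<m+n i (<-trans (s≤s z≤n) 2<N)) (s≤s b) (n<1+n _)
          (trans (p-step j i s) (sym (p-cong (i + N) i ([m+n]%n≡m%n i N)))))

  p-irreflexive : ∀ i → ¬ Adj B₀ (p i) (p i)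
  p-irreflexive i a = p-apart i (suc i) (n<1+n i)
    (subst (_< i + N) (+-comm i 1) (+-monoʳ-< i (<-trans (s≤s (s≤s z≤n)) 2<N)))
    (sym ([ p-step i i , p-step i i ]′ (f-induced (ix i) (ix i) a)))

module Chords {N : ℕ} (2<N : 2 < N) {B₀ : Board} {c : Colour} (f : Fin N → ℕ)
  (f-injective : ∀ {i j} → f i ≡ f j → i ≡ j)
  (f-edge : ∀ i j → Cycle N i j → AdjC B₀ c (f i) (f j))
  (f-induced : ∀ i j → Adj B₀ (f i) (f j) → Cycle N i j)
  (t : ℕ) (1≤t : 1 ≤ t) (N≡ : N ≡ 2 + 4 * t) where

  open Periodic 2<N {c = c} f f-injective f-edge f-induced

  -- e = n + 1; the arc of n vertices from i + e to i + N is the one that a chord at i closes.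
  e : ℕ
  e = 2 + 2 * t

  e<N : e < N
  e<N = subst (e <_) (sym N≡) (≤-by 1 (+-mono-≤ 1≤t 1≤t) (lem t))
    where
    lem : ∀ t → 2 + 4 * t + (1 + 1) ≡ suc (2 + 2 * t) + 1 + (t + t)
    lem = solve-∀

  t+t<N : t + t < N
  t+t<N = subst (t + t <_) (sym N≡) (≤-by (suc (2 * t)) (z≤n {0}) (lem t))
    where
    lem : ∀ t → 2 + 4 * t + 0 ≡ suc (t + t) + suc (2 * t) + 0
    lem = solve-∀

  pos : ℕ → ℕ
  pos k = k * e

  b : ℕ → ℕ
  b k = p (pos k)

  private
    p-+N : ∀ x y → x ≡ y + N → p x ≡ p y
    p-+N x y q = trans (cong p (trans q (cong (y +_) (sym (+-identityʳ N))))) (p-periodic y 1)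

    wrap : ∀ a → e + a + 2 * t ≡ a + N
    wrap a = trans (lem t a) (cong (a +_) (sym N≡))
      where
      lem : ∀ t a → 2 + 2 * t + a + 2 * t ≡ a + (2 + 4 * t)
      lem = solve-∀

  -- A chord has displacement `e` from one end and `2 * t` from the other, as these add up to `N`;
  -- likewise a cycle edge has 1 and `N` - 1. The bound is the same however many chords have been
  -- drawn.
  record Chorded (B : Board) : Set where
    field
      unit : ∀ i → AdjC B c (p i) (p (suc i))
      chord : ∀ i j → i < j → j < i + N → Adj B (p i) (p j) →
        j ≡ suc i ⊎ suc j ≡ i + N ⊎ j ≡ i + 2 * t ⊎ j ≡ i + e
      irreflexive : ∀ i → ¬ Adj B (p i) (p i)
  open Chorded

  chorded₀ : Chorded B₀
  chorded₀ = record { unit = p-edge ; irreflexive = p-irreflexive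
    ; chord = λ i j l l′ a → [ inj₁ , inj₂ ∘ inj₁ ]′ (p-adj i j l l′ a) }

  chorded-grows : ∀ {B B′} a → Grows (SameEdge (p a) (p (e + a))) B B′ → Chorded B → Chorded B′
  chorded-grows {B} {B′} a g χ = record
    { unit = keep g ∘ unit χ
    ; irreflexive = λ i → irreflexive χ i ∘ loop g
    ; chord = λ i j l l′ → [ chord χ i j l l′ , inj₂ ∘ inj₂ ∘ go i j l l′ ]′ ∘ new g }
    where
    go : ∀ i j → i < j → j < i + N → SameEdge (p a) (p (e + a)) (p i) (p j) → j ≡ i + 2 * t ⊎ j ≡ i + e
    go i j l l′ (inj₁ (q , q′)) = inj₂ (p-unique i j (i + e) (<⇒≤ l) (m≤m+n i e) l′ (+-monoʳ-< i e<N)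
      (trans (sym q′) (trans (cong p (+-comm e a)) (p-shift a i e q))))
    go i j l l′ (inj₂ (q , q′)) = inj₁ (p-unique i j (i + 2 * t) (<⇒≤ l) (m≤m+n i (2 * t)) l′
      (+-monoʳ-< i (subst (_< N) (cong (t +_) (sym (+-identityʳ t))) t+t<N))
      (trans (sym q) (trans (sym (p-+N _ a (wrap a))) (p-shift (e + a) i (2 * t) q′))))

  -- The `2 * t` steps from `e + a` lead around to `a + N`, the other end of the chord.
  -- Displacements `e` and `N` - 1 do not fit into this arc, and `2 * t` joins only its ends.
  red-window : ∀ {B} a → Chorded B → Edge B c (p a) (p (e + a)) → MonoInducedCopy (Cycle (suc (2 * t))) B
  red-window {B} a χ ab = window⇒copy {c = c} (2 * t) p o
    (λ x _ → irreflexive χ (o + x))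
    (λ x l → apart x (suc x) (n<1+n x) l , subst (λ y → AdjC B c (p (o + x)) (p y)) (sym (+-suc o x)) (unit χ (o + x)))
    (Edge-sym {B = B} (subst (λ y → Edge B c y (p o)) (sym (p-+N _ a (wrap a))) ab))
    apart
    (λ x y l l′ ad → ends x y l l′ (chord χ (o + x) (o + y) (+-monoʳ-< o l) (close x y l′) ad))
    where
    o = e + a
    close : ∀ x y → y ≤ 2 * t → o + y < o + x + N
    close x y l′ = ≤-<-trans (+-monoʳ-≤ o l′) (<-≤-trans (+-monoʳ-< o
      (subst (_< N) (cong (t +_) (sym (+-identityʳ t))) t+t<N)) (+-monoˡ-≤ N (m≤m+n o x)))
    apart : ∀ x y → x < y → y ≤ 2 * t → p (o + x) ≢ p (o + y)
    apart x y l l′ = p-apart (o + x) (o + y) (+-monoʳ-< o l) (close x y l′)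
    ends : ∀ x y → x < y → y ≤ 2 * t →
      o + y ≡ suc (o + x) ⊎ suc (o + y) ≡ o + x + N ⊎ o + y ≡ o + x + 2 * t ⊎ o + y ≡ o + x + e →
      y ≡ suc x ⊎ y ≡ x + 2 * t
    ends x y l l′ (inj₁ q) = inj₁ (+-cancelˡ-≡ o y (suc x) (trans q (sym (+-suc o x))))
    ends x y l l′ (inj₂ (inj₁ q)) = absurd-by (x + 2 * t)
      (+-mono-≤ (≤-reflexive (trans (sym (cong (o + x +_) N≡)) (sym q))) l′) (lem o x y t)
      where
      lem : ∀ o x y t → o + x + (2 + 4 * t) + y ≡ suc (suc (o + y) + 2 * t + (x + 2 * t))
      lem = solve-∀
    ends x y l l′ (inj₂ (inj₂ (inj₁ q))) = inj₂ (+-cancelˡ-≡ o y (x + 2 * t) (trans q (+-assoc o x (2 * t))))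
    ends x y l l′ (inj₂ (inj₂ (inj₂ q))) = absurd-by (suc x)
      (+-mono-≤ (≤-reflexive (sym q)) l′) (lem o x y t)
      where
      lem : ∀ o x y t → o + x + (2 + 2 * t) + y ≡ suc (o + y + 2 * t + suc x)
      lem = solve-∀

  private
    -- Two chords advance by `2 * e`, which is `N + 2`, hence by 2 modulo `N`; an odd number of
    -- chords leaves one further `e`.
    b-even : ∀ i u → b (i + 2 * u) ≡ p (pos i + 2 * u)
    b-even i u = trans (cong p (trans (lem i u t) (cong (λ x → i * e + 2 * u + u * x) (sym N≡))))
      (p-periodic (pos i + 2 * u) u)
      where
      lem : ∀ i u t → (i + 2 * u) * (2 + 2 * t) ≡ i * (2 + 2 * t) + 2 * u + u * (2 + 4 * t)
      lem = solve-∀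
    b-odd : ∀ i u → b (i + suc (2 * u)) ≡ p (pos i + (2 * u + e))
    b-odd i u = trans (cong p (trans (lem i u t) (cong (λ x → i * e + (2 * u + e) + u * x) (sym N≡))))
      (p-periodic (pos i + (2 * u + e)) u)
      where
      lem : ∀ i u t → (i + suc (2 * u)) * (2 + 2 * t) ≡ i * (2 + 2 * t) + (2 * u + (2 + 2 * t)) + u * (2 + 4 * t)
      lem = solve-∀

  -- The 2t + 1 chords close up because their total displacement is `t + 1` times `N`. Displacements
  -- between the chosen vertices are even, so no cycle edge joins two of them; by size, `e` occurs
  -- only between successive vertices and `2 * t` only between the first and the last.
  blue-ring : ∀ {B} → Chorded B → (∀ i → i < suc (2 * t) → Edge B (flip c) (b i) (b (suc i))) →
    MonoInducedCopy (Cycle (suc (2 * t))) B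
  blue-ring {B} χ β = ring⇒copy {c = flip c} (suc (2 * t)) b
    (λ i l → β i (<-trans (n<1+n i) l))
    (λ { _ refl → subst (Edge B (flip c) (b (2 * t))) b-closes (β (2 * t) (n<1+n _)) })
    (λ i j l l′ → apart i j l l′ (<⇒+ l))
    (λ i j l l′ → ind i j l l′ (<⇒+ l))
    (λ i _ → irreflexive χ (pos i))
    where
    b-closes : b (suc (2 * t)) ≡ b 0
    b-closes = trans (cong p (trans (lem t) (cong (suc t *_) (sym N≡)))) (p-periodic 0 (suc t))
      where
      lem : ∀ t → suc (2 * t) * (2 + 2 * t) ≡ suc t * (2 + 4 * t)
      lem = solve-∀
    module _ (i u : ℕ) where
      even-bound : i + 2 * u < suc (2 * t) → 2 * u < N
      even-bound l = subst (2 * u <_) (sym N≡) (≤-by (suc (i + 2 * t)) l (lem i u t))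
        where
        lem : ∀ i u t → 2 + 4 * t + suc (i + 2 * u) ≡ suc (2 * u) + suc (i + 2 * t) + suc (2 * t)
        lem = solve-∀
      odd-bound : i + suc (2 * u) < suc (2 * t) → 2 * u + e < N
      odd-bound l = subst (2 * u + e <_) (sym N≡) (≤-by i l (lem i u t))
        where
        lem : ∀ i u t → 2 + 4 * t + suc (i + suc (2 * u)) ≡ suc (2 * u + (2 + 2 * t)) + i + suc (2 * t)
        lem = solve-∀
    apart : ∀ i j → i < j → j < suc (2 * t) → (∃ λ k → j ≡ i + suc k) → b i ≢ b j
    apart i _ l l′ (k , refl) q with suc k in s | parity (suc k)
    ... | .(2 * u) | u , inj₁ refl = p-apart (pos i) (pos i + 2 * u)
      (m<m+n (pos i) (subst (0 <_) s (s≤s z≤n)))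
      (+-monoʳ-< (pos i) (even-bound i u l′)) (trans q (b-even i u))
    ... | .(suc (2 * u)) | u , inj₂ refl = p-apart (pos i) (pos i + (2 * u + e))
      (m<m+n (pos i) (≤-trans (s≤s z≤n) (m≤n+m e (2 * u))))
      (+-monoʳ-< (pos i) (odd-bound i u l′)) (trans q (b-odd i u))
    ind : ∀ i j → i < j → j < suc (2 * t) → (∃ λ k → j ≡ i + suc k) → Adj B (b i) (b j) →
      j ≡ suc i ⊎ (i ≡ 0 × suc j ≡ suc (2 * t))
    ind i _ l l′ (k , refl) a with suc k in s | parity (suc k)
    ... | .(2 * u) | u , inj₁ refl = go (chord χ (pos i) (pos i + 2 * u)
            (m<m+n (pos i) (subst (0 <_) s (s≤s z≤n))) (+-monoʳ-< (pos i) (even-bound i u l′))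
            (subst (Adj B (b i)) (b-even i u) a))
      where
      go : pos i + 2 * u ≡ suc (pos i) ⊎ suc (pos i + 2 * u) ≡ pos i + N ⊎ pos i + 2 * u ≡ pos i + 2 * t ⊎
        pos i + 2 * u ≡ pos i + e → i + 2 * u ≡ suc i ⊎ (i ≡ 0 × suc (i + 2 * u) ≡ suc (2 * t))
      go (inj₁ q) = ⊥-elim (even≢odd u 0 (+-cancelˡ-≡ (pos i) _ _ (trans q (+-comm 1 (pos i)))))
      go (inj₂ (inj₁ q)) = ⊥-elim (even≢odd (suc (2 * t)) u (sym
        (trans (+-cancelˡ-≡ (pos i) _ _ (trans (+-suc (pos i) (2 * u)) q)) (trans N≡ (lem t)))))
        where
        lem : ∀ t → 2 + 4 * t ≡ 2 * suc (2 * t)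
        lem = solve-∀
      go (inj₂ (inj₂ (inj₁ q))) = inj₂ (i≡0 , cong suc (trans (cong (_+ 2 * u) i≡0) u≡t))
        where
        u≡t = +-cancelˡ-≡ (pos i) (2 * u) (2 * t) q
        i≡0 = n≤0⇒n≡0 (+-cancelʳ-≤ (2 * u) i 0 (≤-trans (≤-pred l′) (≤-reflexive (sym u≡t))))
      go (inj₂ (inj₂ (inj₂ q))) = absurd-by (i + 1) (+-mono-≤ (≤-reflexive (sym (+-cancelˡ-≡ (pos i) _ _ q))) l′)
        (lem i u t)
        where
        lem : ∀ i u t → 2 + 2 * t + suc (i + 2 * u) ≡ suc (2 * u + suc (2 * t) + (i + 1))
        lem = solve-∀
    ... | .(suc (2 * u)) | u , inj₂ refl = go (chord χ (pos i) (pos i + (2 * u + e))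
            (m<m+n (pos i) (≤-trans (s≤s z≤n) (m≤n+m e (2 * u)))) (+-monoʳ-< (pos i) (odd-bound i u l′))
            (subst (Adj B (b i)) (b-odd i u) a))
      where
      go : pos i + (2 * u + e) ≡ suc (pos i) ⊎ suc (pos i + (2 * u + e)) ≡ pos i + N ⊎
        pos i + (2 * u + e) ≡ pos i + 2 * t ⊎ pos i + (2 * u + e) ≡ pos i + e →
        i + suc (2 * u) ≡ suc i ⊎ (i ≡ 0 × suc (i + suc (2 * u)) ≡ suc (2 * t))
      go (inj₁ q) = absurd-by (2 * u + 2 * t) (≤-reflexive (+-cancelˡ-≡ (pos i) _ _ (trans q (+-comm 1 (pos i))))) (lem u t)
        where
        lem : ∀ u t → 2 * u + (2 + 2 * t) ≡ suc (1 + (2 * u + 2 * t))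
        lem = solve-∀
      go (inj₂ (inj₁ q)) = ⊥-elim (even≢odd t u (sym (+-cancelʳ-≡ (2 + 2 * t) _ _
        (trans (+-cancelˡ-≡ (pos i) _ _ (trans (+-suc (pos i) _) q)) (trans N≡ (lem t))))))
        where
        lem : ∀ t → 2 + 4 * t ≡ 2 * t + (2 + 2 * t)
        lem = solve-∀
      go (inj₂ (inj₂ (inj₁ q))) = absurd-by (suc (2 * u)) (≤-reflexive (+-cancelˡ-≡ (pos i) _ _ q)) (lem u t)
        where
        lem : ∀ u t → 2 * u + (2 + 2 * t) ≡ suc (2 * t + suc (2 * u))
        lem = solve-∀
      go (inj₂ (inj₂ (inj₂ q))) = inj₁ (trans (cong (λ x → i + suc x)
        (+-cancelʳ-≡ e (2 * u) 0 (+-cancelˡ-≡ (pos i) _ _ q))) (+-comm i 1))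

  -- `k` chords have already received the colour `flip c`. A chord of colour `c` ends the game at
  -- once.
  play : ∀ {B} r k → k + r ≡ suc (2 * t) → Chorded B → (∀ i → i < k → Edge B (flip c) (b i) (b (suc i))) →
    Wins (Cycle (suc (2 * t))) r B
  play zero k q χ β = done (blue-ring χ λ i l → β i (subst (i <_) (trans (sym q) (+-identityʳ k)) l))
  play (suc r) k q χ β = join-either c {b k} {b (suc k)}
    (λ z → p-apart (pos k) (pos k + e) (m<m+n (pos k) (s≤s z≤n)) (+-monoʳ-< (pos k) e<N)
      (trans z (cong p (+-comm e (pos k)))))
    (λ g r → done (red-window (pos k) (chorded-grows (pos k) g χ) r))
    (λ {B′} g r′ → play r (suc k) (trans (sym (+-suc k r)) q) (chorded-grows (pos k) g χ)
      λ i l → [ (λ l′ → Edge-grows g (β i l′)) , (λ { refl → r′ }) ]′ (m≤n⇒m<n∨m≡n (≤-pred l)))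

-- The given strategy is followed to its end and the chords come after it. Inducedness concerns only
-- the vertices of the cycle, so the rest of the board may be arbitrary.
halve-cycle : ∀ {N B} t → 1 ≤ t → N ≡ 2 + 4 * t → Wins (Cycle N) m B → Wins (Cycle (suc (2 * t))) (m + suc (2 * t)) B
halve-cycle {N = N} t 1≤t N≡ (done (c , f , inj , edge , ind)) = Wins-mono (m≤n+m _ _) (play (suc (2 * t)) 0 refl chorded₀ (λ _ ()))
  where
  2<N : 2 < N
  2<N = subst (2 <_) (sym N≡) (+-monoʳ-< 2 (≤-trans 1≤t (m≤n*m t 4)))
  open Chords 2<N {c = c} f inj edge ind t 1≤t N≡
halve-cycle t 1≤t N≡ (step u v n a w) = step u v n a λ c → halve-cycle t 1≤t N≡ (w c)

-- Long monochromatic induced paths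

-- Generic in vertices and relations because it describes both paths on the board and paths of
-- cells. The head of the list is the end at which paths grow.
data Path {A : Set} (E N : A → A → Set) : List A → Set where
  [] : Path E N []
  [-] : ∀ {x} → Path E N (x ∷ [])
  cons : ∀ {x y ys} → E x y → All (N x) ys → Path E N (y ∷ ys) → Path E N (x ∷ y ∷ ys)

Path-tail : ∀ {E N : A → A → Set} {x xs} → Path E N (x ∷ xs) → Path E N xs
Path-tail [-] = []
Path-tail (cons _ _ π) = π

Path-drop : ∀ {E N : A → A → Set} k {xs} → Path E N xs → Path E N (drop k xs)
Path-drop zero π = π
Path-drop (suc k) [] = []
Path-drop (suc k) π@[-] = Path-drop k (Path-tail π)
Path-drop (suc k) π@(cons _ _ _) = Path-drop k (Path-tail π)

Path-map : ∀ {E N : A → A → Set} {E′ N′ : A′ → A′ → Set} (f : A → A′) →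
  (∀ {x y} → E x y → E′ (f x) (f y)) → (∀ {x y} → N x y → N′ (f x) (f y)) →
  ∀ {xs} → Path E N xs → Path E′ N′ (map f xs)
Path-map f e n [] = []
Path-map f e n [-] = [-]
Path-map f e n (cons x a π) = cons (e x) (All.map⁺ (All.map n a)) (Path-map f e n π)

Path-map∈ : ∀ {E N E′ N′ : A → A → Set} {xs} →
  (∀ {x y} → E x y → E′ x y) → (∀ {x y} → x ∈ xs → y ∈ xs → N x y → N′ x y) →
  Path E N xs → Path E′ N′ xs
Path-map∈ e n [] = []
Path-map∈ e n [-] = [-]
Path-map∈ e n (cons x a π) = cons (e x) (All.tabulate λ i → n (here refl) (there (there i)) (All.lookup a i))
  (Path-map∈ e (λ i j → n (there i) (there j)) π)

MonoPath : Board → Colour → List ℕ → Set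
MonoPath B c = Path (Edge B c) (NonEdge B)

-- Since `NonEdge` includes distinctness, separate lists are also disjoint.
Separate : Board → List ℕ → List ℕ → Set
Separate B X Y = All (λ x → All (NonEdge B x) Y) X

MonoPath-distinct : ∀ {x xs} → MonoPath B c (x ∷ xs) → All (x ≢_) xs
MonoPath-distinct [-] = []
MonoPath-distinct (cons (n , _) a _) = n ∷ All.map proj₁ a

-- New edges that all meet S cannot join two vertices outside S.
Meets : List ℕ → ℕ → ℕ → Set
Meets S x y = x ∈ S ⊎ y ∈ S

-- Sharper than `Meets`: a pair stays non-adjacent as soon as one of its vertices lies outside `S`.
Within : List ℕ → ℕ → ℕ → Set
Within S x y = x ∈ S × y ∈ S

Disjoint : List ℕ → List ℕ → Set
Disjoint S X = All (λ s → All (s ≢_) X) S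

disjoint : ∀ {S X x} → Disjoint S X → x ∈ X → ¬ x ∈ S
disjoint d i j = All.lookup (All.lookup d j) i refl

meets₁ : ∀ {a b S} → a ∈ S → Grows (SameEdge a b) B B′ → Grows (Meets S) B B′
meets₁ i = grows-map λ { (inj₁ (refl , _)) → inj₁ i ; (inj₂ (refl , _)) → inj₂ i }

meets₂ : ∀ {a b S} → b ∈ S → Grows (SameEdge a b) B B′ → Grows (Meets S) B B′
meets₂ i = grows-map λ { (inj₁ (_ , refl)) → inj₂ i ; (inj₂ (_ , refl)) → inj₁ i }

within : ∀ {a b S} → a ∈ S → b ∈ S → Grows (SameEdge a b) B B′ → Grows (Within S) B B′
within i j = grows-map λ { (inj₁ (refl , refl)) → i , j ; (inj₂ (refl , refl)) → j , i }

module _ {S : List ℕ} (g : Grows (Meets S) B B′) where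
  private
    safe : ∀ {X Y} → Disjoint S X → Disjoint S Y → ∀ {x y} → x ∈ X → y ∈ Y → ¬ Meets S x y
    safe d d′ i j = [ disjoint d i , disjoint d′ j ]′

  path-meets : ∀ {X} → Disjoint S X → MonoPath B c X → MonoPath B′ c X
  path-meets d = Path-map∈ (Edge-grows g) λ i j → NonEdge-grows g (safe d d i j)

  nonEdges-meets : ∀ {x Y} → Disjoint S (x ∷ Y) → All (NonEdge B x) Y → All (NonEdge B′ x) Y
  nonEdges-meets d a = All.tabulate λ i → NonEdge-grows g (safe d d (here refl) (there i)) (All.lookup a i)

  separate-meets : ∀ {X Y} → Disjoint S X → Disjoint S Y → Separate B X Y → Separate B′ X Y
  separate-meets d d′ s = All.tabulate λ i → All.tabulate λ j →
    NonEdge-grows g (safe d d′ i j) (All.lookup (All.lookup s i) j)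

separate-within : ∀ {S X Y} → Grows (Within S) B B′ → Disjoint S Y → Separate B X Y → Separate B′ X Y
separate-within g d s = All.tabulate λ i → All.tabulate λ j →
  NonEdge-grows g (disjoint d j ∘ proj₂) (All.lookup (All.lookup s i) j)

Separate-sym : ∀ {X Y} → Separate B X Y → Separate B Y X
Separate-sym {B = B} s = All.tabulate λ i → All.tabulate λ j → NonEdge-sym {B = B} (All.lookup (All.lookup s j) i)

Path-skip : ∀ {E N : A → A → Set} {x xs} → Path E N (x ∷ xs) → All (N x) (drop 1 xs)
Path-skip [-] = []
Path-skip (cons _ a _) = a

IsEdge : Board → Colour → List ℕ → Set
IsEdge B c P = ∃₂ λ x y → P ≡ x ∷ y ∷ [] × Edge B c x y

-- The side path has the other colour; Ps are the edges of colour c that have not been used yet.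
record Stage (B : Board) (c : Colour) (R Q : List ℕ) (Ps : List (List ℕ)) : Set where
  constructor stage
  field
    main  : MonoPath B c R
    side  : MonoPath B (flip c) Q
    edges : All (IsEdge B c) Ps
    apart : AllPairs (Separate B) (R ∷ Q ∷ Ps)

module _ {S : List ℕ} (g : Grows (Within S) B B′) where
  edges-within : ∀ {Ps} → All (IsEdge B c) Ps → All (IsEdge B′ c) Ps
  edges-within = All.map λ (x , y , q , e) → x , y , q , Edge-grows g e

  apart-within : ∀ {Ps} → All (Disjoint S) Ps → AllPairs (Separate B) Ps → AllPairs (Separate B′) Ps
  apart-within [] [] = []
  apart-within (_ ∷ ds) (a ∷ as) =
    All.zipWith (λ (d , s) → separate-within g d s) (ds , a) ∷ apart-within ds as

private
  length-pred : ∀ (xs : List ℕ) → length xs ≤ suc (length (drop 1 xs))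
  length-pred [] = z≤n
  length-pred (x ∷ xs) = ≤-refl

  -- The four outcomes change the lengths of main and side path by at least (3, -2), (2, -1), (-2,
  -- 2) and (0, 1); with the weights 4 and 5 each is worth at least 2.
  gain₁ : ∀ a b b′ → b ≤ suc b′ → 2 + (4 * suc a + 5 * suc b) ≤ 4 * (4 + a) + 5 * b′
  gain₁ a b b′ l = ≤-by 0 (*-monoʳ-≤ 5 l) (lem a b b′)
    where
    lem : ∀ a b b′ → 4 * (4 + a) + 5 * b′ + 5 * b ≡ 2 + (4 * suc a + 5 * suc b) + 0 + 5 * suc b′
    lem = solve-∀

  gain₂ : ∀ a b → 2 + (4 * suc a + 5 * suc b) ≤ 4 * (3 + a) + 5 * b
  gain₂ a b = ≤-by 1 (z≤n {0}) (lem a b)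
    where
    lem : ∀ a b → 4 * (3 + a) + 5 * b + 0 ≡ 2 + (4 * suc a + 5 * suc b) + 1 + 0
    lem = solve-∀

  gain₃ : ∀ a b a′ → a ≤ suc a′ → 2 + (4 * suc a + 5 * suc b) ≤ 4 * a′ + 5 * (3 + b)
  gain₃ a b a′ l = ≤-by 0 (*-monoʳ-≤ 4 l) (lem a b a′)
    where
    lem : ∀ a b a′ → 4 * a′ + 5 * (3 + b) + 4 * a ≡ 2 + (4 * suc a + 5 * suc b) + 0 + 4 * suc a′
    lem = solve-∀

  gain₄ : ∀ a b → 2 + (4 * suc a + 5 * suc b) ≤ 4 * suc a + 5 * (2 + b)
  gain₄ a b = ≤-by 3 (z≤n {0}) (lem a b)
    where
    lem : ∀ a b → 4 * suc a + 5 * (2 + b) + 0 ≡ 2 + (4 * suc a + 5 * suc b) + 3 + 0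
    lem = solve-∀

-- Spending one edge on the two paths

module UseEdge {B v R q Q x₁ x₂ Ps}
  (πR : MonoPath B c (v ∷ R)) (πQ : MonoPath B (flip c) (q ∷ Q)) (e : Edge B c x₁ x₂) (es : All (IsEdge B c) Ps)
  (sRQ : Separate B (v ∷ R) (q ∷ Q)) (sRA : Separate B (v ∷ R) (x₁ ∷ x₂ ∷ [])) (sQA : Separate B (q ∷ Q) (x₁ ∷ x₂ ∷ []))
  (sRP : All (Separate B (v ∷ R)) Ps) (sQP : All (Separate B (q ∷ Q)) Ps) (sAP : All (Separate B (x₁ ∷ x₂ ∷ [])) Ps)
  (sP : AllPairs (Separate B) Ps) where

  S : List ℕ
  S = v ∷ q ∷ x₁ ∷ x₂ ∷ []

  vQ : All (NonEdge B v) (q ∷ Q)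
  vQ = All.head sRQ
  sQR : Separate B (q ∷ Q) (v ∷ R)
  sQR = Separate-sym sRQ
  sAR : Separate B (x₁ ∷ x₂ ∷ []) (v ∷ R)
  sAR = Separate-sym sRA
  sAQ : Separate B (x₁ ∷ x₂ ∷ []) (q ∷ Q)
  sAQ = Separate-sym sQA
  x₁R : All (NonEdge B x₁) (v ∷ R)
  x₁R = All.head sAR
  x₂R : All (NonEdge B x₂) (v ∷ R)
  x₂R = All.head (All.tail sAR)
  x₁Q : All (NonEdge B x₁) (q ∷ Q)
  x₁Q = All.head sAQ
  x₂Q : All (NonEdge B x₂) (q ∷ Q)
  x₂Q = All.head (All.tail sAQ)

  q#R : All (q ≢_) (v ∷ R)
  q#R = All.map proj₁ (All.head sQR)
  q#Q : All (q ≢_) Q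
  q#Q = MonoPath-distinct πQ
  v#R : All (v ≢_) R
  v#R = MonoPath-distinct πR
  v#Q : All (v ≢_) (q ∷ Q)
  v#Q = All.map proj₁ vQ
  x₁#R : All (x₁ ≢_) (v ∷ R)
  x₁#R = All.map proj₁ x₁R
  x₂#R : All (x₂ ≢_) (v ∷ R)
  x₂#R = All.map proj₁ x₂R
  x₁#Q : All (x₁ ≢_) (q ∷ Q)
  x₁#Q = All.map proj₁ x₁Q
  x₂#Q : All (x₂ ≢_) (q ∷ Q)
  x₂#Q = All.map proj₁ x₂Q
  x₁≢x₂ : x₁ ≢ x₂
  x₁≢x₂ = proj₁ e
  x₂≢x₁ : x₂ ≢ x₁
  x₂≢x₁ = ≢-sym x₁≢x₂
  q≢x₁ : q ≢ x₁
  q≢x₁ = ≢-sym (All.head x₁#Q)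
  q≢x₂ : q ≢ x₂
  q≢x₂ = ≢-sym (All.head x₂#Q)
  v≢x₁ : v ≢ x₁
  v≢x₁ = ≢-sym (All.head x₁#R)
  v≢x₂ : v ≢ x₂
  v≢x₂ = ≢-sym (All.head x₂#R)

  drop′ : ∀ {P : ℕ → Set} {xs} → All P xs → All P (drop 1 xs)
  drop′ = All.drop⁺ 1

  Others : Board → List ℕ → Set
  Others B P = Separate B (v ∷ R) P × Separate B (q ∷ Q) P × Separate B (x₁ ∷ x₂ ∷ []) P

  others : All (Others B) Ps
  others = All.zip (sRP , All.zip (sQP , sAP))

  clear : All (Disjoint S) Ps
  clear = All.map (λ { ((v# ∷ _) , (q# ∷ _) , (x₁# ∷ x₂# ∷ [])) →
    All.map proj₁ v# ∷ All.map proj₁ q# ∷ All.map proj₁ x₁# ∷ All.map proj₁ x₂# ∷ [] }) others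

  -- All new edges lie inside `S` and the remaining edges of the stock avoid `S`, so these stay
  -- separate from everything; `f` distributes the separations over the rearranged paths.
  finish : ∀ {B′ R′ Q′} → Grows (Within S) B B′ → MonoPath B′ c R′ → MonoPath B′ (flip c) Q′ →
    Separate B′ R′ Q′ → (∀ {P} → Others B′ P → Separate B′ R′ P × Separate B′ Q′ P) → Stage B′ c R′ Q′ Ps
  finish g πR πQ s f = stage πR πQ (edges-within g es)
    ((s ∷ All.map proj₁ sP′) ∷ All.map proj₂ sP′ ∷ apart-within g clear sP)
    where
    sP′ = All.zipWith (λ (d , a , b , c) → f
      (separate-within g d a , separate-within g d b , separate-within g d c)) (clear , others)

  v∈ : v ∈ S
  v∈ = here refl
  q∈ : q ∈ S
  q∈ = there (here refl)
  x₁∈ : x₁ ∈ S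
  x₁∈ = there (there (here refl))
  x₂∈ : x₂ ∈ S
  x₂∈ = there (there (there (here refl)))

  -- `x₂` is given up, being adjacent to `x₁` in colour `c`; the main path is not touched.
  extend-side : ∀ {B₁} → Grows (SameEdge q x₁) B B₁ → Edge B₁ (flip c) q x₁ → Stage B₁ c (v ∷ R) (x₁ ∷ q ∷ Q) Ps
  extend-side {B₁} g e₁ = finish (within q∈ x₁∈ g)
    (path-meets h (q#R ∷ []) πR)
    (cons (Edge-sym {B = B₁} e₁) (nonEdges-meets h ((q≢x₁ ∷ q#Q) ∷ []) (All.tail x₁Q))
      (path-meets h′ (x₁#Q ∷ []) πQ))
    (Separate-sym (nonEdges-meets h ((q≢x₁ ∷ q#R) ∷ []) x₁R ∷
      separate-meets h′ (x₁#Q ∷ []) (x₁#R ∷ []) sQR))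
    λ { (sR , sQ , (s₁ ∷ _)) → sR , s₁ ∷ sQ }
    where
    h : Grows (Meets (q ∷ [])) B B₁
    h = meets₁ (here refl) g
    h′ : Grows (Meets (x₁ ∷ [])) B B₁
    h′ = meets₂ (here refl) g

  -- The two `c`-edges at `q` carry it over to the main path. The next vertex of the side path is
  -- adjacent to `q` and must be discarded too; `drop 1` also covers the case that there is none.
  extend-main-through-q : ∀ {B₁ B₂} → Grows (SameEdge q x₁) B B₁ → Edge B₁ c q x₁ →
    Grows (SameEdge q v) B₁ B₂ → Edge B₂ c q v → Stage B₂ c (x₂ ∷ x₁ ∷ q ∷ v ∷ R) (drop 1 Q) Ps
  extend-main-through-q {B₁} {B₂} g₁ e₁ g₂ e₂ = finish g
    (cons (Edge-sym {B = B₂} (Edge-grows g e))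
      (All.head (nonEdges-meets h′ ((x₁≢x₂ ∷ All.head x₁#Q ∷ []) ∷ (v≢x₂ ∷ All.head v#Q ∷ []) ∷ []) (All.head x₂Q ∷ []))
        ∷ nonEdges-meets h ((q≢x₂ ∷ q#R) ∷ []) x₂R)
      (cons (Edge-sym {B = B₂} (Edge-grows g₂ e₁)) (nonEdges-meets h ((q≢x₁ ∷ q#R) ∷ []) x₁R)
        (cons e₂ (nonEdges-meets h′ ((All.head x₁#Q ∷ All.tail x₁#R) ∷ (All.head v#Q ∷ v#R) ∷ []) (All.tail (All.head sQR)))
          (path-meets h (q#R ∷ []) πR))))
    (path-meets h (q#Q′ ∷ []) (Path-drop 2 πQ))
    (nonEdges-meets h′ ((x₁≢x₂ ∷ drop′ (All.tail x₁#Q)) ∷ (v≢x₂ ∷ drop′ (All.tail v#Q)) ∷ []) (drop′ (All.tail x₂Q))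
      ∷ nonEdges-meets h ((q≢x₁ ∷ q#Q′) ∷ []) (drop′ (All.tail x₁Q))
      ∷ nonEdges-meets h′ ((All.head x₁#Q ∷ drop′ (All.tail x₁#Q)) ∷ (All.head v#Q ∷ drop′ (All.tail v#Q)) ∷ []) (Path-skip πQ)
      ∷ separate-meets h (q#R ∷ []) (q#Q′ ∷ []) (All.map (drop′ ∘ All.tail) sRQ))
    λ { (sR , (sq ∷ sQ) , (s₁ ∷ s₂ ∷ [])) → s₂ ∷ s₁ ∷ sq ∷ sR , drop′ sQ }
    where
    q#Q′ : All (q ≢_) (drop 1 Q)
    q#Q′ = drop′ q#Q
    g : Grows (Within S) B B₂
    g = grows-trans (within q∈ x₁∈ g₁) (within q∈ v∈ g₂)
    h : Grows (Meets (q ∷ [])) B B₂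
    h = grows-trans (meets₁ (here refl) g₁) (meets₁ (here refl) g₂)
    h′ : Grows (Meets (x₁ ∷ v ∷ [])) B B₂
    h′ = grows-trans (meets₂ (here refl) g₁) (meets₂ (there (here refl)) g₂)

  module _ {B₁ B₂ B₃} (g₁ : Grows (SameEdge q x₁) B B₁)
    (g₂ : Grows (SameEdge q v) B₁ B₂) (e₂ : Edge B₂ (flip c) q v) (g₃ : Grows (SameEdge v x₂) B₂ B₃) where
    private
      g : Grows (Within S) B B₃
      g = grows-trans (within q∈ x₁∈ g₁) (grows-trans (within q∈ v∈ g₂) (within v∈ x₂∈ g₃))
      h : Grows (Meets (q ∷ x₂ ∷ [])) B B₃
      h = grows-trans (meets₁ (here refl) g₁) (grows-trans (meets₁ (here refl) g₂) (meets₂ (there (here refl)) g₃))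
      h′ : Grows (Meets (q ∷ v ∷ [])) B B₃
      h′ = grows-trans (meets₁ (here refl) g₁) (grows-trans (meets₁ (here refl) g₂) (meets₁ (there (here refl)) g₃))
      h″ : Grows (Meets (x₁ ∷ v ∷ [])) B B₃
      h″ = grows-trans (meets₂ (here refl) g₁) (grows-trans (meets₂ (there (here refl)) g₂) (meets₁ (there (here refl)) g₃))

    -- `q` is adjacent to both `x₁` and `v`, so it leaves the side path, and the main path takes
    -- `x₂` and then `x₁`.
    extend-main-by-edge : Edge B₃ c v x₂ → Stage B₃ c (x₁ ∷ x₂ ∷ v ∷ R) Q Ps
    extend-main-by-edge e₃ = finish g
      (cons (Edge-grows g e) (nonEdges-meets h ((q≢x₁ ∷ q#R) ∷ (x₂≢x₁ ∷ x₂#R) ∷ []) x₁R)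
        (cons (Edge-sym {B = B₃} e₃) (nonEdges-meets h′ ((q≢x₂ ∷ All.tail q#R) ∷ (v≢x₂ ∷ v#R) ∷ []) (All.tail x₂R))
          (path-meets h (q#R ∷ x₂#R ∷ []) πR)))
      (path-meets h (q#Q ∷ All.tail x₂#Q ∷ []) (Path-tail πQ))
      (nonEdges-meets h′ ((q≢x₁ ∷ q#Q) ∷ (v≢x₁ ∷ All.tail v#Q) ∷ []) (All.tail x₁Q)
        ∷ nonEdges-meets h′ ((q≢x₂ ∷ q#Q) ∷ (v≢x₂ ∷ All.tail v#Q) ∷ []) (All.tail x₂Q)
        ∷ separate-meets h (q#R ∷ x₂#R ∷ []) (q#Q ∷ All.tail x₂#Q ∷ []) (All.map All.tail sRQ))
      λ { (sR , (_ ∷ sQ) , (s₁ ∷ s₂ ∷ [])) → s₁ ∷ s₂ ∷ sR , sQ }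

    -- `v` changes to the side path. Its former neighbour on the main path is discarded, and so is
    -- `x₁`, a neighbour of both `x₂` and `q`.
    extend-side-through-v : Edge B₃ (flip c) v x₂ → Stage B₃ c (drop 1 R) (x₂ ∷ v ∷ q ∷ Q) Ps
    extend-side-through-v e₃ = finish g
      (path-meets h′ (drop′ (All.tail q#R) ∷ drop′ v#R ∷ []) (Path-drop 2 πR))
      (cons (Edge-sym {B = B₃} e₃) (nonEdges-meets h″ ((x₁≢x₂ ∷ x₁#Q) ∷ (v≢x₂ ∷ v#Q) ∷ []) x₂Q)
        (cons (Edge-sym {B = B₃} (Edge-grows g₃ e₂))
          (nonEdges-meets h ((All.head q#R ∷ q#Q) ∷ (≢-sym v≢x₂ ∷ All.tail x₂#Q) ∷ []) (All.tail vQ))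
          (path-meets h″ (x₁#Q ∷ v#Q ∷ []) πQ)))
      (Separate-sym
        (nonEdges-meets h′ ((q≢x₂ ∷ drop′ (All.tail q#R)) ∷ (v≢x₂ ∷ drop′ v#R) ∷ []) (drop′ (All.tail x₂R))
        ∷ nonEdges-meets h ((All.head q#R ∷ drop′ (All.tail q#R)) ∷ (≢-sym v≢x₂ ∷ drop′ (All.tail x₂#R)) ∷ []) (Path-skip πR)
        ∷ separate-meets h″ (x₁#Q ∷ v#Q ∷ []) (drop′ (All.tail x₁#R) ∷ drop′ v#R ∷ []) (All.map (drop′ ∘ All.tail) sQR)))
      λ { ((sv ∷ sR) , sQ , (_ ∷ s₂ ∷ [])) → drop′ sR , s₂ ∷ sv ∷ sQ }

  advance : Loopless B →
    (∀ {B′ R′ Q′} → Loopless B′ → Stage B′ c R′ Q′ Ps →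
      2 + (4 * suc (length R) + 5 * suc (length Q)) ≤ 4 * length R′ + 5 * length Q′ → Wins H m B′) →
    Wins H (3 + m) B
  advance ll K =
    join-either c q≢x₁
      (λ g₁ e₁ → join-either c (All.head q#R)
        (λ g₂ e₂ → Wins-mono (n≤1+n _) (K (loopless-grows (grows-trans (within q∈ x₁∈ g₁) (within q∈ v∈ g₂)) ll)
          (extend-main-through-q g₁ e₁ g₂ e₂) (gain₁ (length R) (length Q) (length (drop 1 Q)) (length-pred Q))))
        (λ g₂ e₂ → join-either c v≢x₂
          (λ g₃ e₃ → K (ll₃ g₁ g₂ g₃) (extend-main-by-edge g₁ g₂ e₂ g₃ e₃) (gain₂ (length R) (length Q)))
          (λ g₃ e₃ → K (ll₃ g₁ g₂ g₃) (extend-side-through-v g₁ g₂ e₂ g₃ e₃)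
            (gain₃ (length R) (length Q) (length (drop 1 R)) (length-pred R)))))
      (λ g₁ e₁ → Wins-mono (m≤n+m _ 2) (K (loopless-grows g₁ ll) (extend-side g₁ e₁)
        (gain₄ (length R) (length Q))))
    where
    ll₃ : ∀ {B₁ B₂ B₃} → Grows (SameEdge q x₁) B B₁ → Grows (SameEdge q v) B₁ B₂ → Grows (SameEdge v x₂) B₂ B₃ →
      Loopless B₃
    ll₃ g₁ g₂ g₃ = loopless-grows (grows-trans (within q∈ x₁∈ g₁) (grows-trans (within q∈ v∈ g₂) (within v∈ x₂∈ g₃))) ll

private
  long-enough : ∀ L a b → 9 * L ≤ 4 * a + 5 * b + 0 → L ≤ a ⊎ L ≤ b
  long-enough L a b h with L ≤? a | L ≤? b
  ... | yes l | _ = inj₁ l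
  ... | no _ | yes l = inj₂ l
  ... | no l | no l′ = absurd-by 8 (+-mono-≤ h (+-mono-≤ (*-monoʳ-≤ 4 (≰⇒> l)) (*-monoʳ-≤ 5 (≰⇒> l′)))) (lem L a b)
    where
    lem : ∀ L a b → 9 * L + (4 * suc a + 5 * suc b) ≡ suc (4 * a + 5 * b + 0 + (4 * L + 5 * L) + 8)
    lem = solve-∀

  spend : ∀ {l Φ Φ′} n → 2 + Φ ≤ Φ′ → l ≤ Φ + 2 * suc n → l ≤ Φ′ + 2 * n
  spend {l} {Φ} {Φ′} n g h = ≤-by 0 (+-mono-≤ g h) (lem l Φ Φ′ n)
    where
    lem : ∀ l Φ Φ′ n → Φ′ + 2 * n + (2 + Φ + l) ≡ l + 0 + (Φ′ + (Φ + 2 * suc n))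
    lem = solve-∀

  gain₅ : ∀ b → 2 + (4 * 0 + 5 * b) ≤ 4 * 2 + 5 * b
  gain₅ b = +-monoˡ-≤ (5 * b) (s≤s (s≤s (z≤n {6})))

  gain₆ : ∀ a → 2 + (4 * a + 5 * 0) ≤ 4 * a + 5 * 1
  gain₆ a = ≤-by 3 (z≤n {0}) (lem a)
    where
    lem : ∀ a → 4 * a + 5 * 1 + 0 ≡ 2 + (4 * a + 5 * 0) + 3 + 0
    lem = solve-∀

-- When the edges run out, a potential of `9 * L` forces one of the paths to have length `L`. An
-- empty path needs no round: the edge itself starts the main path, or its first vertex the side
-- path.
use-edges : ∀ L Ps {B R Q} → Loopless B → Stage B c R Q Ps →
  9 * L ≤ 4 * length R + 5 * length Q + 2 * length Ps →
  (∀ {B′ d X} → Loopless B′ → MonoPath B′ d X → L ≤ length X → Wins H m B′) →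
  Wins H (length Ps * 3 + m) B
use-edges L [] {R = R} {Q} ll (stage πR πQ _ _) h K with long-enough L (length R) (length Q) h
... | inj₁ l = K ll πR l
... | inj₂ l = K ll πQ l
use-edges L (P ∷ Ps) {R = []} {Q} ll (stage _ πQ ((x , y , refl , e) ∷ es) (_ ∷ (sQP ∷ sQPs) ∷ sPPs ∷ sPs)) h K =
  Wins-mono (m≤n+m _ 3) (use-edges L Ps ll
    (stage (cons e [] [-]) πQ es ((Separate-sym sQP ∷ sPPs) ∷ sQPs ∷ sPs)) (spend (length Ps) (gain₅ (length Q)) h) K)
use-edges L (P ∷ Ps) {R = v ∷ R} {[]} ll (stage πR _ ((x , y , refl , e) ∷ es) ((_ ∷ sRP ∷ sRPs) ∷ _ ∷ sPPs ∷ sPs)) h K =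
  Wins-mono (m≤n+m _ 3) (use-edges L Ps ll
    (stage πR [-] es ((All.map (λ { (n ∷ _) → n ∷ [] }) sRP ∷ sRPs) ∷ All.map (λ { (n ∷ _) → n ∷ [] }) sPPs ∷ sPs))
    (spend (length Ps) (gain₆ (suc (length R))) h) K)
use-edges L (P ∷ Ps) {R = v ∷ R} {q ∷ Q} ll
  (stage πR πQ ((x , y , refl , e) ∷ es) ((sRQ ∷ sRP ∷ sRPs) ∷ (sQP ∷ sQPs) ∷ sPPs ∷ sPs)) h K =
  UseEdge.advance πR πQ e es sRQ sRP sQP sRPs sQPs sPPs sPs ll
    λ ll′ σ g → use-edges L Ps ll′ σ (spend (length Ps) g h) K

-- Collecting disjoint edges of one colour

record Stock (B : Board) (F : ℕ) (c : Colour) (Ps : List (List ℕ)) : Set where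
  constructor stock
  field
    edges : All (IsEdge B c) Ps
    apart : AllPairs (Separate B) Ps
    below : All (All (_< F)) Ps

module _ {F B B′} (g : Grows (SameEdge F (suc F)) B B′) where
  stock-keep : ∀ {Ps} → Stock B F c Ps → Stock B′ (2 + F) c Ps
  stock-keep (stock es as bs) = stock (All.map (λ (x , y , q , e) → x , y , q , Edge-grows g e) es)
    (go bs as) (All.map (All.map (λ l → <-trans l (s≤s (n≤1+n F)))) bs)
    where
    away : ∀ {P} → All (_< F) P → Disjoint [ F ] P
    away b = All.map (λ l → ≢-sym (<⇒≢ l)) b ∷ []
    go : ∀ {Ps} → All (All (_< F)) Ps → AllPairs (Separate B) Ps → AllPairs (Separate B′) Ps
    go [] [] = []
    go (b ∷ bs) (a ∷ as) = All.zipWith (λ (b′ , s) → separate-meets (meets₁ (here refl) g) (away b) (away b′) s) (bs , a) ∷ go bs as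

  stock-add : ∀ {Ps} → (∀ x y → Adj B x y → x < F) → Edge B′ c F (suc F) → Stock B F c Ps →
    Stock B′ (2 + F) c ((F ∷ suc F ∷ []) ∷ Ps)
  stock-add fresh e s@(stock _ _ bs) with stock-keep s
  ... | stock es as bs′ = stock ((_ , _ , refl , e) ∷ es)
    (All.map (λ b → All.map far₀ b ∷ All.map far₁ b ∷ []) bs ∷ as)
    ((s≤s (n≤1+n F) ∷ ≤-refl ∷ []) ∷ bs′)
    where
    far₀ : ∀ {x} → x < F → NonEdge B′ F x
    far₀ l = ≢-sym (<⇒≢ l) , λ a → [ (λ a → <-irrefl refl (fresh _ _ a)) ,
      (λ { (inj₁ (_ , refl)) → <⇒≱ l (n≤1+n F) ; (inj₂ (refl , _)) → <-irrefl refl l }) ]′ (new g a)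
    far₁ : ∀ {x} → x < F → NonEdge B′ (suc F) x
    far₁ l = ≢-sym (<⇒≢ (<-trans l (n<1+n F))) , λ a → [ (λ a → <⇒≱ (fresh _ _ a) (n≤1+n F)) ,
      (λ { (inj₁ (q , _)) → 1+n≢n (sym q) ; (inj₂ (refl , _)) → <-irrefl refl l }) ]′ (new g a)

  fresh-grows : (∀ x y → Adj B x y → x < F) → ∀ x y → Adj B′ x y → x < 2 + F
  fresh-grows fresh x y a with new g a
  ... | inj₁ a = <-trans (fresh x y a) (s≤s (n≤1+n F))
  ... | inj₂ (inj₁ (refl , _)) = s≤s (n≤1+n F)
  ... | inj₂ (inj₂ (_ , refl)) = ≤-refl

-- Vertices from `F` on are untouched, and `a`, `b` count the red and blue edges still missing. Each
-- round lowers one of the two, so one colour is complete within `a + b` rounds.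
collect-edges : ∀ n a b {B F rs bs} → Loopless B → (∀ x y → Adj B x y → x < F) →
  Stock B F red rs → Stock B F blue bs → length rs + a ≡ n → length bs + b ≡ n →
  (∀ {B′ c Ps} → Loopless B′ → Stage B′ c [] [] Ps → length Ps ≡ n → Wins H m B′) →
  Wins H (a + b + m) B
collect-edges n zero b ll fr (stock es as _) _ ra _ K =
  Wins-mono (m≤n+m _ b) (K ll (stage [] [] es (([] ∷ All.map (λ _ → []) es) ∷ All.map (λ _ → []) es ∷ as)) (trans (sym (+-identityʳ _)) ra))
collect-edges n (suc a) zero ll fr _ (stock es as _) _ rb K =
  Wins-mono (m≤n+m _ (suc a + 0)) (K ll (stage [] [] es (([] ∷ All.map (λ _ → []) es) ∷ All.map (λ _ → []) es ∷ as)) (trans (sym (+-identityʳ _)) rb))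
collect-edges {m = m} n (suc a) (suc b) {F = F} ll fr sr sb ra rb K = join {x = F} {y = suc F} (λ q → 1+n≢n (sym q)) λ
  { red g e → collect-edges n a (suc b) (loopless-grows g ll) (fresh-grows g fr)
      (stock-add g fr e sr) (stock-keep g sb) (trans (sym (+-suc _ a)) ra) rb K
  ; blue g e → Wins-mono (≤-reflexive (cong (_+ m) (sym (+-suc a b))))
      (collect-edges n (suc a) b (loopless-grows g ll) (fresh-grows g fr)
      (stock-keep g sr) (stock-add g fr e sb) ra (trans (sym (+-suc _ b)) rb) K) }

-- Potential 2 per edge makes `n` edges enough. Collecting them takes `n + n` rounds and using them
-- 3 rounds each.
long-path : ∀ L n → 9 * L ≤ 2 * n →
  (∀ {B c X} → Loopless B → MonoPath B c X → L ≤ length X → Wins H m B) →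
  Wins H (n + n + (n * 3 + m)) []
long-path L n h K = collect-edges n n n {F = 0} (λ _ ()) (λ _ _ ()) (stock [] [] []) (stock [] [] []) refl refl
  λ { {Ps = Ps} ll σ refl → use-edges L Ps ll σ h K }

-- Legs and the spider

-- Uniqueness of division with only one remainder known to be below `α`; knowing the order of the
-- quotients makes up for the other, which is needed where a move may lead to a column beyond `α`.
≤-lanes : ∀ {r ρ α} m μ → r < α → m ≤ μ → r + m * α ≡ ρ + μ * α → r ≡ ρ × m ≡ μ
≤-lanes {r} {ρ} {α} m μ r< m≤μ q with m≤n⇒m<n∨m≡n m≤μ
... | inj₂ refl = +-cancelʳ-≡ (m * α) r ρ q , refl
... | inj₁ l = ⊥-elim (<-irrefl q (<-≤-trans (+-monoˡ-< (m * α) r<) (≤-trans (*-monoˡ-≤ α l) (m≤n+m (μ * α) ρ))))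

lanes : ∀ {r ρ α} m μ → r < α → ρ < α → r + m * α ≡ ρ + μ * α → r ≡ ρ × m ≡ μ
lanes m μ r< ρ< q with ≤-total m μ
... | inj₁ l = ≤-lanes m μ r< l q
... | inj₂ l = let a , b = ≤-lanes μ m ρ< l (sym q) in sym a , sym b

-- Columns and lanes of a leg

module Leg (t : ℕ) (1≤t : 1 ≤ t) where

  -- `M` positions hold the columns 0 to `3 * t` in the lanes 0 to 2; the last one is
  -- `3 * t + 2 * α`.
  α M : ℕ
  α = suc (4 * t)
  M = suc (3 * t + 2 * α)

  Game : ℕ → Board → Set
  Game = Wins (Cycle (suc α))

  -- 2 + 2α = (3 + α) + (α - 1), so a chord of displacement 2 + 2α closes a cycle on α + 1 vertices with one of
  -- displacement 3 + α at the same vertex.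
  Chord : ℕ → ℕ → Set
  Chord i j = j ≡ suc i ⊎ j ≡ i + α ⊎ j ≡ i + (3 + α) ⊎ j ≡ i + (2 + 2 * α)

  -- The position r + m α of the path is addressed as (column r , lane m).
  Cell : Set
  Cell = ℕ × ℕ

  ν : Cell → ℕ
  ν (r , m) = r + m * α

  -- The last clause leaves room in lane 0 for a step of three columns; it keeps the target column
  -- below `α`, so that the address of the target is unambiguous.
  Valid : Cell → Set
  Valid (r , m) = r ≤ 3 * t × m ≤ 2 × (m ≡ 0 → 3 + r ≤ 3 * t)

  Near : Cell → Cell → Set
  Near (r , m) (r′ , m′) =
    (r′ ≡ suc r × m′ ≡ m) ⊎ (r′ ≡ r × m′ ≡ suc m) ⊎ (r′ ≡ 3 + r × m′ ≡ suc m) ⊎ (r′ ≡ 2 + r × m′ ≡ 2 + m)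

  -- Mentions no board: far cells are non-adjacent whichever chords of the four displacements have
  -- been drawn, so a path of cells stays induced while only such chords are added.
  record Far (x y : Cell) : Set where
    constructor mk-far
    field
      validˡ : Valid x
      validʳ : Valid y
      unequal : x ≢ y
      ¬nearˡ : ¬ Near x y
      ¬nearʳ : ¬ Near y x

  private
    column< : ∀ {r} → r ≤ 3 * t → suc r < α
    column< l = ≤-by 0 (+-mono-≤ l 1≤t) (lem _ t)
      where
      lem : ∀ r t → suc (4 * t) + (r + 1) ≡ suc (suc r) + 0 + (3 * t + t)
      lem = solve-∀

  ν<M : ∀ {x} → Valid x → ν x < M
  ν<M (l , l′ , _) = s≤s (+-mono-≤ l (*-monoˡ-≤ α l′))

  ν-injective : ∀ {x y} → Valid x → Valid y → ν x ≡ ν y → x ≡ y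
  ν-injective {r , m} {r′ , m′} (l , _) (l′ , _) q =
    let a , b = lanes m m′ (<-trans (n<1+n r) (column< l)) (<-trans (n<1+n r′) (column< l′)) q in cong₂ _,_ a b

  chord⇒near : ∀ {x y} → Valid x → Valid y → Chord (ν x) (ν y) → Near x y
  chord⇒near {r , m} {r′ , m′} (l , _ , z) (l′ , l″ , _) = go
    where
    r′< : r′ < α
    r′< = <-trans (n<1+n r′) (column< l′)
    e₁ : ∀ r m α → r + m * α + α ≡ r + suc m * α
    e₁ = solve-∀
    e₂ : ∀ r m α → r + m * α + (3 + α) ≡ 3 + r + suc m * α
    e₂ = solve-∀
    e₃ : ∀ r m α → r + m * α + (2 + 2 * α) ≡ 2 + r + (2 + m) * α
    e₃ = solve-∀
    go : Chord (r + m * α) (r′ + m′ * α) → Near (r , m) (r′ , m′)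
    go (inj₁ q) = inj₁ (lanes m′ m r′< (column< l) q)
    go (inj₂ (inj₁ q)) = inj₂ (inj₁ (lanes m′ (suc m) r′< (<-trans (n<1+n r) (column< l)) (trans q (e₁ r m α))))
    go (inj₂ (inj₂ (inj₁ q))) = inj₂ (inj₂ (inj₁ (third m z (trans q (e₂ r m α)))))
      where
      -- In lane 0, `z` keeps column `3 + r` below `α`; from a later lane the target lane is at
      -- least 2, hence at least `m′`.
      third : ∀ m → (m ≡ 0 → 3 + r ≤ 3 * t) → r′ + m′ * α ≡ 3 + r + suc m * α → r′ ≡ 3 + r × m′ ≡ suc m
      third zero z q = lanes m′ 1 r′< (<-trans (n<1+n _) (column< (z refl))) q
      third (suc m) z q = ≤-lanes m′ (2 + m) r′< (≤-trans l″ (s≤s (s≤s z≤n))) q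
    go (inj₂ (inj₂ (inj₂ q))) = inj₂ (inj₂ (inj₂ (≤-lanes m′ (2 + m) r′< (≤-trans l″ (s≤s (s≤s z≤n))) (trans q (e₃ r m α)))))

  -- The cells behind a tip at `(j , 0)`. Column `j` - 1 is left free: from there a unit step could
  -- reach column `j`, and a step of three columns could reach column `2 + j`.
  Old : ℕ → Cell → Set
  Old j x@(r , m) = Valid x × ((r ≡ j × 1 ≤ m) ⊎ 2 + r ≤ j)

  private
    -- No move lowers the column, so only the direction towards the larger column has to be
    -- excluded.
    far-by : ∀ {r m r′ m′} → Valid (r′ , m′) → Valid (r , m) → r < r′ → ¬ Near (r , m) (r′ , m′) → Far (r′ , m′) (r , m)
    far-by {r} {m} v v′ l n = mk-far v v′ (λ { refl → <-irrefl refl l }) back n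
      where
      back : ¬ Near _ (r , m)
      back (inj₁ (refl , _)) = <⇒≱ l (n≤1+n _)
      back (inj₂ (inj₁ (refl , _))) = <-irrefl refl l
      back (inj₂ (inj₂ (inj₁ (refl , _)))) = <⇒≱ l (m≤n+m _ 3)
      back (inj₂ (inj₂ (inj₂ (refl , _)))) = <⇒≱ l (m≤n+m _ 2)

  -- Only the chord `3 + α` from column `j` reaches column `3 + j`, and it raises the lane by one.
  far₃ : ∀ {j r m μ} → Valid (3 + j , μ) → Valid (r , m) → r ≤ j → (r ≡ j → μ ≢ suc m) → Far (3 + j , μ) (r , m)
  far₃ {j} {r} {m} {μ} v v′ l n = far-by v v′ (≤-trans (s≤s l) (m≤n+m _ 2)) not
    where
    not : ¬ Near (r , m) (3 + j , μ)
    not (inj₁ (refl , _)) = <⇒≱ l (n≤1+n _)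
    not (inj₂ (inj₁ (refl , _))) = <⇒≱ l (m≤n+m _ 2)
    not (inj₂ (inj₂ (inj₁ (q , q′)))) = n (sym (+-cancelˡ-≡ 3 j r q)) q′
    not (inj₂ (inj₂ (inj₂ (refl , _)))) = <-irrefl refl l

  -- Only the chord `2 + 2 * α` from column `j` reaches column `2 + j`; a step of three columns
  -- would have to start in the free column `j` - 1.
  far₂ : ∀ {j r m μ} → Valid (2 + j , μ) → Valid (r , m) → r ≡ j ⊎ 2 + r ≤ j → (r ≡ j → μ ≢ 2 + m) → Far (2 + j , μ) (r , m)
  far₂ {j} {r} {m} {μ} v v′ l n = far-by v v′ (s≤s (≤-trans r≤j (n≤1+n j))) (not l)
    where
    r≤j : r ≤ j
    r≤j = [ ≤-reflexive , (λ l → ≤-trans (m≤n+m r 2) l) ]′ l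
    not : r ≡ j ⊎ 2 + r ≤ j → ¬ Near (r , m) (2 + j , μ)
    not _ (inj₁ (refl , _)) = <-irrefl refl r≤j
    not _ (inj₂ (inj₁ (refl , _))) = <⇒≱ r≤j (n≤1+n _)
    not (inj₁ refl) (inj₂ (inj₂ (inj₁ (q , _)))) = 1+n≢n (sym (+-cancelˡ-≡ 2 _ _ q))
    not (inj₂ l) (inj₂ (inj₂ (inj₁ (refl , _)))) = 1+n≰n l
    not _ (inj₂ (inj₂ (inj₂ (q , q′)))) = n (sym (+-cancelˡ-≡ 2 j r q)) q′

  -- The displacement `2 * α` is not among the four.
  far₀ : ∀ {r} → Valid (r , 0) → Valid (r , 2) → Far (r , 0) (r , 2)
  far₀ v v′ = mk-far v v′ (λ ())
    (λ { (inj₁ (() , _)) ; (inj₂ (inj₁ (_ , ()))) ; (inj₂ (inj₂ (inj₁ (() , _)))) ; (inj₂ (inj₂ (inj₂ (() , _)))) })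
    (λ { (inj₁ (() , _)) ; (inj₂ (inj₁ (_ , ()))) ; (inj₂ (inj₂ (inj₁ (() , _)))) ; (inj₂ (inj₂ (inj₂ (() , _)))) })

  -- Growing a leg along an induced path

  module Grow {B₀ : Board} {c : Colour} (p : ℕ → ℕ) (π : InducedPath B₀ c p M) (ll₀ : Loopless B₀) where

    OnPath : ℕ → Set
    OnPath x = ∃ λ i → i < M × x ≡ p i

    record Chorded (B : Board) : Set where
      field
        unit : ∀ i → suc i < M → Edge B c (p i) (p (suc i))
        chord : ∀ i j → i < j → j < M → Adj B (p i) (p j) → Chord i j
        loopless : Loopless B
        grown : Grows (λ x y → OnPath x × OnPath y) B₀ B
    open Chorded

    chorded₀ : Chorded B₀
    chorded₀ = record { unit = edge π ; chord = λ i j l b → inj₁ ∘ adjacent π i j l b ; loopless = ll₀ ; grown = grows-refl }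

    p-injective : ∀ {i j} → i < M → j < M → p i ≡ p j → i ≡ j
    p-injective {i} {j} b b′ q with <-cmp i j
    ... | tri< l _ _ = ⊥-elim (distinct π i j l b′ q)
    ... | tri≈ _ e _ = e
    ... | tri> _ _ l = ⊥-elim (distinct π j i l b (sym q))

    chorded-grows : ∀ {B B′ i j} → i < j → j < M → Chord i j → Chorded B →
      Grows (SameEdge (p i) (p j)) B B′ → Chorded B′
    chorded-grows {B} {B′} {i} {j} l b d χ g = record
      { unit = λ a b′ → Edge-grows g (unit χ a b′)
      ; chord = λ a a′ l′ b′ → [ chord χ a a′ l′ b′ , go a a′ l′ b′ ]′ ∘ new g
      ; loopless = loopless-grows g (loopless χ)
      ; grown = grows-trans (grown χ) (grows-map (λ
          { (inj₁ (refl , refl)) → (i , i<M , refl) , (j , b , refl)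
          ; (inj₂ (refl , refl)) → (j , b , refl) , (i , i<M , refl) }) g) }
      where
      i<M = <-trans l b
      go : ∀ a a′ → a < a′ → a′ < M → SameEdge (p i) (p j) (p a) (p a′) → Chord a a′
      go a a′ l′ b′ (inj₁ (q , q′)) = subst₂ Chord (p-injective i<M (<-trans l′ b′) q) (p-injective b b′ q′) d
      go a a′ l′ b′ (inj₂ (q , q′)) = ⊥-elim (<-asym l
        (subst₂ _<_ (sym (p-injective b (<-trans l′ b′) q′)) (sym (p-injective i<M b′ q)) l′))

    -- The displacements `3 + α` and `2 + 2 * α` do not fit into a window of `α + 1` vertices, so
    -- the chord closes an induced cycle.
    α-chord⇒copy : ∀ {B} → Chorded B → ∀ i → i + α < M → Edge B c (p i) (p (i + α)) → MonoInducedCopy (Cycle (suc α)) B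
    α-chord⇒copy {B} χ i b e = window⇒copy {c = c} α p i (λ x _ → loopless χ (p (i + x)))
      (λ x l → subst (λ y → Edge B c (p (i + x)) (p y)) (sym (+-suc i x)) (unit χ (i + x) (subst (_< M) (+-suc i x) (inside l))))
      e (λ x y l l′ → distinct π (i + x) (i + y) (+-monoʳ-< i l) (inside l′))
      λ x y l l′ a → go x y l′ (chord χ (i + x) (i + y) (+-monoʳ-< i l) (inside l′) a)
      where
      inside : ∀ {x} → x ≤ α → i + x < M
      inside l = ≤-<-trans (+-monoʳ-≤ i l) b
      cancel : ∀ {x y} z → i + y ≡ i + x + z → y ≡ x + z
      cancel {x} {y} z q = +-cancelˡ-≡ i y (x + z) (trans q (+-assoc i x z))
      go : ∀ x y → y ≤ α → Chord (i + x) (i + y) → y ≡ suc x ⊎ y ≡ x + α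
      go x y l (inj₁ q) = inj₁ (+-cancelˡ-≡ i y (suc x) (trans q (sym (+-suc i x))))
      go x y l (inj₂ (inj₁ q)) = inj₂ (cancel α q)
      go x y l (inj₂ (inj₂ (inj₁ q))) = ⊥-elim (<⇒≱ (≤-trans (m≤n+m (suc α) (x + 2)) (≤-reflexive (lem x t))) (subst (_≤ α) (cancel _ q) l))
        where
        lem : ∀ x t → x + 2 + suc (suc (4 * t)) ≡ x + (3 + suc (4 * t))
        lem = solve-∀
      go x y l (inj₂ (inj₂ (inj₂ q))) = ⊥-elim (<⇒≱ (≤-trans (m≤n+m (suc α) (x + (1 + α))) (≤-reflexive (lem x t))) (subst (_≤ α) (cancel _ q) l))
        where
        lem : ∀ x t → x + (1 + suc (4 * t)) + suc (suc (4 * t)) ≡ x + (2 + 2 * suc (4 * t))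
        lem = solve-∀

    -- The segment from `i + (3 + α)` to `i + (2 + 2 * α)` has `α` vertices, too few for a chord
    -- inside, and chords from `i` reach it only at its two ends.
    β-chord⇒copy : ∀ {B} → Chorded B → ∀ i → i + (2 + 2 * α) < M → Edge B c (p i) (p (i + (3 + α))) →
      Edge B c (p i) (p (i + (2 + 2 * α))) → MonoInducedCopy (Cycle (suc α)) B
    β-chord⇒copy {B} χ i b e e′ = path⇒copy {c = c} {g = g} (4 * t) (≤-trans 1≤t (m≤n*m t 4)) (loopless χ)
      (record
        { edge = λ a l → subst (λ y → Edge B c (g a) (p y)) (sym (+-suc o a))
            (unit χ (o + a) (subst (_< M) (+-suc o a) (inside (≤-pred l))))
        ; far = λ a a′ l l′ → distinct π (o + a) (o + a′) (+-monoʳ-< o (<-trans (n<1+n a) l)) (inside (≤-pred l′)) ,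
            λ ad → no-chord a a′ l (≤-pred l′) (chord χ (o + a) (o + a′) (+-monoʳ-< o (<-trans (n<1+n a) l)) (inside (≤-pred l′)) ad) })
      (subst (λ y → Edge B c (p i) (p y)) (sym (+-identityʳ o)) e)
      (subst (λ y → Edge B c (p i) (p y)) (sym (end t i)) e′)
      λ a l → distinct π i (o + suc a) (i<o a) (inside (<⇒≤ l)) ,
        λ ad → no-spoke a l (chord χ i (o + suc a) (i<o a) (inside (<⇒≤ l)) ad)
      where
      o = i + (3 + α)
      g = λ a → p (o + a)
      end : ∀ t i → i + (3 + suc (4 * t)) + 4 * t ≡ i + (2 + 2 * suc (4 * t))
      end = solve-∀
      inside : ∀ {x} → x ≤ 4 * t → o + x < M
      inside l = ≤-<-trans (+-monoʳ-≤ o l) (subst (_< M) (sym (end t i)) b)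
      i<o : ∀ a → i < o + suc a
      i<o a = <-≤-trans (m<m+n i (s≤s z≤n)) (m≤m+n o (suc a))
      too-far : ∀ {a a′ z} {A : Set} → a′ ≤ 4 * t → α ≤ z → o + a′ ≡ o + a + z → A
      too-far {a} {a′} {z} l lz q = ⊥-elim (<⇒≱ (s≤s l) (≤-trans lz (≤-trans (m≤n+m z a)
        (≤-reflexive (sym (+-cancelˡ-≡ o a′ (a + z) (trans q (+-assoc o a z))))))))
      no-chord : ∀ a a′ → suc a < a′ → a′ ≤ 4 * t → ¬ Chord (o + a) (o + a′)
      no-chord a a′ l l′ (inj₁ q) = <-irrefl (sym (+-cancelˡ-≡ o a′ (suc a) (trans q (sym (+-suc o a))))) l
      no-chord a a′ l l′ (inj₂ (inj₁ q)) = too-far l′ ≤-refl q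
      no-chord a a′ l l′ (inj₂ (inj₂ (inj₁ q))) = too-far l′ (m≤n+m α 3) q
      no-chord a a′ l l′ (inj₂ (inj₂ (inj₂ q))) = too-far l′ (≤-trans (m≤m+n α (α + 0)) (m≤n+m (2 * α) 2)) q
      no-spoke : ∀ a → suc a < 4 * t → ¬ Chord i (o + suc a)
      no-spoke a l c = go (subst (Chord i) (+-assoc i (3 + α) (suc a)) c)
        where
        shorter : ∀ {z} → z < 3 + α + suc a → ¬ i + (3 + α + suc a) ≡ i + z
        shorter l q = <-irrefl (sym (+-cancelˡ-≡ i _ _ q)) l
        go : ¬ Chord i (i + (3 + α + suc a))
        go (inj₁ q) = shorter (s≤s (s≤s z≤n)) (trans q (+-comm 1 i))
        go (inj₂ (inj₁ q)) = shorter (≤-trans (m≤n+m (suc α) 2) (m≤m+n (3 + α) (suc a))) q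
        go (inj₂ (inj₂ (inj₁ q))) = shorter (m<m+n (3 + α) (s≤s z≤n)) q
        go (inj₂ (inj₂ (inj₂ q))) = <-irrefl (+-cancelˡ-≡ i _ _ q)
          (<-≤-trans (+-monoʳ-< (3 + α) l) (≤-reflexive (end′ t)))
          where
          end′ : ∀ t → 3 + suc (4 * t) + 4 * t ≡ 2 + 2 * suc (4 * t)
          end′ = solve-∀

    Far⇒NonEdge : ∀ {B x y} → Chorded B → Far x y → NonEdge B (p (ν x)) (p (ν y))
    Far⇒NonEdge {B} {x} {y} χ (mk-far v v′ n a b) = (λ q → n (ν-injective v v′ (p-injective (ν<M v) (ν<M v′) q))) , go
      where
      go : ¬ Adj B (p (ν x)) (p (ν y))
      go ad with <-cmp (ν x) (ν y)
      ... | tri< l _ _ = a (chord⇒near v v′ (chord χ (ν x) (ν y) l (ν<M v′) ad))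
      ... | tri≈ _ q _ = n (ν-injective v v′ q)
      ... | tri> _ _ l = b (chord⇒near v′ v (chord χ (ν y) (ν x) l (ν<M v) (Adj-sym ad)))

    CellEdge : Board → Cell → Cell → Set
    CellEdge B x y = Edge B (flip c) (p (ν x)) (p (ν y))

    CellPath : Board → List Cell → Set
    CellPath B = Path (CellEdge B) Far

    cellPath-grows : ∀ {W B B′ xs} → Grows W B B′ → CellPath B xs → CellPath B′ xs
    cellPath-grows g = Path-map∈ (Edge-grows g) (λ _ _ f → f)

    private
      join-chord : ∀ {B m i j} → i < j → j < M → Chord i j → Chorded B →
        (∀ {B′} → Chorded B′ → Grows (SameEdge (p i) (p j)) B B′ → Edge B′ c (p i) (p j) → Game m B′) →
        (∀ {B′} → Chorded B′ → Grows (SameEdge (p i) (p j)) B B′ → Edge B′ (flip c) (p i) (p j) → Game m B′) →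
        Game (suc m) B
      join-chord {i = i} {j} l b d χ K₁ K₂ = join-either c (distinct π i j l b)
        (λ g → K₁ (chorded-grows l b d χ g) g) (λ g → K₂ (chorded-grows l b d χ g) g)

    descend : ∀ {B m r μ} → Valid (r , suc μ) → Chorded B →
      (∀ {B′ W} → Chorded B′ → Grows W B B′ → CellEdge B′ (r , μ) (r , suc μ) → Game m B′) → Game (suc m) B
    descend {B} {r = r} {μ} v χ K = join-chord (m<m+n i (s≤s z≤n)) b (inj₂ (inj₁ refl)) χ
      (λ χ′ _ e → done (α-chord⇒copy χ′ i b e))
      (λ {B′} χ′ g e → K χ′ g (subst (λ z → Edge B′ (flip c) (p i) (p z)) (lem r μ α) e))
      where
      i = ν (r , μ)
      lem : ∀ r μ α → r + μ * α + α ≡ r + suc μ * α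
      lem = solve-∀
      b : i + α < M
      b = subst (_< M) (sym (lem r μ α)) (ν<M v)

    -- If both chords had colour `c`, a cycle would be closed. The first outcome saves a round.
    ascend : ∀ {B m j} → 3 + j ≤ 3 * t → Chorded B →
      (∀ {B′ W} → Chorded B′ → Grows W B B′ → CellEdge B′ (3 + j , 1) (j , 0) → Game (suc m) B′) →
      (∀ {B′ W} → Chorded B′ → Grows W B B′ → CellEdge B′ (2 + j , 2) (j , 0) → Game m B′) →
      Game (2 + m) B
    ascend {j = j} l χ K₁ K₂ = join-chord {i = i} (m<m+n i (s≤s z≤n)) b₁ (inj₂ (inj₂ (inj₁ refl))) χ
      (λ χ′ g e → join-chord (m<m+n i (s≤s z≤n)) b₂ (inj₂ (inj₂ (inj₂ refl))) χ′
        (λ χ″ g′ e′ → done (β-chord⇒copy χ″ i b₂ (Edge-grows g′ e) e′))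
        (λ {B″} χ″ g′ e′ → K₂ χ″ (grows-trans (grows-map inj₁ g) (grows-map inj₂ g′))
          (Edge-sym {B = B″} (subst (λ z → Edge B″ (flip c) (p i) (p z)) (lem₂ j α) e′))))
      (λ {B′} χ′ g e → K₁ χ′ g (Edge-sym {B = B′} (subst (λ z → Edge B′ (flip c) (p i) (p z)) (lem₁ j α) e)))
      where
      i = ν (j , 0)
      lem₁ : ∀ j α → j + 0 * α + (3 + α) ≡ 3 + j + 1 * α
      lem₁ = solve-∀
      lem₂ : ∀ j α → j + 0 * α + (2 + 2 * α) ≡ 2 + j + 2 * α
      lem₂ = solve-∀
      b₁ : i + (3 + α) < M
      b₁ = subst (_< M) (sym (lem₁ j α)) (ν<M (l , s≤s z≤n , λ ()))
      b₂ : i + (2 + 2 * α) < M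
      b₂ = subst (_< M) (sym (lem₂ j α)) (ν<M (≤-trans (n≤1+n _) l , ≤-refl , λ ()))

    EndsIn : Cell → List Cell → Set
    EndsIn z xs = ∃ λ ys → xs ≡ ys ++ z ∷ []

    endsIn-cons : ∀ {x z xs} → EndsIn z xs → EndsIn z (x ∷ xs)
    endsIn-cons {x} (ys , q) = x ∷ ys , cong (x ∷_) q

    private
      olds₃ : ∀ {j μ xs} → Valid (3 + j , μ) → (∀ m → 1 ≤ m → μ ≢ suc m) → All (Old j) xs → All (Far (3 + j , μ)) xs
      olds₃ v n = All.map λ
        { (v′ , inj₁ (refl , l)) → far₃ v v′ ≤-refl (λ _ → n _ l)
        ; (v′ , inj₂ l) → far₃ v v′ (≤-trans (m≤n+m _ 2) l) (λ { refl → ⊥-elim (<⇒≱ l (n≤1+n _)) }) }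

      olds₂ : ∀ {j μ xs} → Valid (2 + j , μ) → (∀ m → 1 ≤ m → μ ≢ 2 + m) → All (Old j) xs → All (Far (2 + j , μ)) xs
      olds₂ v n = All.map λ
        { (v′ , inj₁ (refl , l)) → far₂ v v′ (inj₁ refl) (λ _ → n _ l)
        ; (v′ , inj₂ l) → far₂ v v′ (inj₂ l) (λ { refl → ⊥-elim (<⇒≱ l (n≤1+n _)) }) }

      age : ∀ {j} d {xs} → All (Old j) xs → All (Old (2 + d + j)) xs
      age {j} d = All.map λ
        { (v , inj₁ (refl , _)) → v , inj₂ (s≤s (s≤s (m≤n+m j d)))
        ; (v , inj₂ l) → v , inj₂ (≤-trans l (m≤n+m j (2 + d))) }

    -- Each turn takes at most 4 rounds, adds at least 2 vertices and returns to lane 0 at most 3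
    -- columns further on. The last turn only ascends, which takes at most 2 rounds.
    grow : ∀ s {B j xs} → Chorded B → CellPath B ((j , 0) ∷ xs) → All (Old j) xs → j + 3 * suc s ≤ 3 * t →
      EndsIn (0 , 0) ((j , 0) ∷ xs) →
      (∀ {B′ ys} → Chorded B′ → CellPath B′ ys → All Valid ys → EndsIn (0 , 0) ys → 2 * suc s + length xs ≤ length ys → Game m B′) →
      Game (s * 4 + (2 + m)) B
    grow zero {j = j} {xs} χ ρ old b end K = ascend b₃ χ
      (λ χ′ g e → Wins-mono (n≤1+n _) (K χ′
        (cons e (olds₃ (b₃ , s≤s z≤n , λ ()) (λ { _ (s≤s _) () }) old) (cellPath-grows g ρ))
        ((b₃ , s≤s z≤n , λ ()) ∷ valid) (endsIn-cons end) ≤-refl))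
      (λ χ′ g e → K χ′
        (cons e (olds₂ (≤-trans (n≤1+n _) b₃ , ≤-refl , λ ()) (λ { _ (s≤s _) () }) old) (cellPath-grows g ρ))
        ((≤-trans (n≤1+n _) b₃ , ≤-refl , λ ()) ∷ valid) (endsIn-cons end) ≤-refl)
      where
      b₃ : 3 + j ≤ 3 * t
      b₃ = subst (_≤ 3 * t) (+-comm j 3) b
      valid : All Valid ((j , 0) ∷ xs)
      valid = (≤-trans (m≤n+m j 3) b₃ , z≤n , λ _ → b₃) ∷ All.map proj₁ old
    grow (suc s) {j = j} {xs} χ ρ old b end K = ascend b₃ χ
      -- Two new vertices in three columns: up one lane and down again.
      (λ χ₁ g₁ e₁ → descend v₃₁ χ₁ λ χ₂ g₂ e₂ → Wins-mono (m≤n+m _ 2) (grow s χ₂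
        (cons e₂ (far₃ v₃₀ vⱼ ≤-refl (λ _ ()) ∷ olds₃ v₃₀ (λ _ _ ()) old)
          (cons (Edge-grows g₂ e₁) (olds₃ v₃₁ (λ { _ (s≤s _) () }) old) (cellPath-grows g₂ (cellPath-grows g₁ ρ))))
        ((v₃₁ , inj₁ (refl , s≤s z≤n)) ∷ (vⱼ , inj₂ (n≤1+n _)) ∷ age 1 old)
        (subst (_≤ 3 * t) (lem₃ j s) b)
        (endsIn-cons (endsIn-cons end))
        λ χ₃ ρ′ v end′ l → K χ₃ ρ′ v end′ (≤-trans (≤-reflexive (sym (len s (length xs)))) l)))
      -- Three new vertices in two columns: up two lanes and down twice. The extra vertex and the
      -- saved column are given away in the bounds.
      (λ χ₁ g₁ e₁ → descend v₂₂ χ₁ λ χ₂ g₂ e₂ → descend v₂₁ χ₂ λ χ₃ g₃ e₃ → grow s χ₃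
        (cons e₃ (far₀ v₂₀ v₂₂ ∷ far₂ v₂₀ vⱼ (inj₁ refl) (λ _ ()) ∷ olds₂ v₂₀ (λ _ _ ()) old)
          (cons (Edge-grows g₃ e₂) (far₂ v₂₁ vⱼ (inj₁ refl) (λ _ ()) ∷ olds₂ v₂₁ (λ _ _ ()) old)
            (cons (Edge-grows g₃ (Edge-grows g₂ e₁)) (olds₂ v₂₂ (λ { _ (s≤s _) () }) old)
              (cellPath-grows g₃ (cellPath-grows g₂ (cellPath-grows g₁ ρ))))))
        ((v₂₁ , inj₁ (refl , s≤s z≤n)) ∷ (v₂₂ , inj₁ (refl , s≤s z≤n)) ∷ (vⱼ , inj₂ ≤-refl) ∷ age 0 old)
        (≤-trans (n≤1+n _) (subst (_≤ 3 * t) (lem₃ j s) b))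
        (endsIn-cons (endsIn-cons (endsIn-cons end)))
        λ χ₄ ρ′ v end′ l → K χ₄ ρ′ v end′ (≤-trans (n≤1+n _) (≤-trans (≤-reflexive (sym (len′ s (length xs)))) l)))
      where
      lem₃ : ∀ j s → j + 3 * suc (suc s) ≡ 3 + j + 3 * suc s
      lem₃ = solve-∀
      len : ∀ s n → 2 * suc s + suc (suc n) ≡ 2 * suc (suc s) + n
      len = solve-∀
      len′ : ∀ s n → 2 * suc s + suc (suc (suc n)) ≡ suc (2 * suc (suc s) + n)
      len′ = solve-∀
      b₆ : 6 + j ≤ 3 * t
      b₆ = ≤-trans (≤-by (3 * s) (z≤n {0}) (lem j s)) b
        where
        lem : ∀ j s → j + 3 * suc (suc s) + 0 ≡ 6 + j + 3 * s + 0
        lem = solve-∀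
      b₃ : 3 + j ≤ 3 * t
      b₃ = ≤-trans (m≤n+m (3 + j) 3) b₆
      vⱼ : Valid (j , 0)
      vⱼ = ≤-trans (m≤n+m j 3) b₃ , z≤n , λ _ → b₃
      v₃₀ : Valid (3 + j , 0)
      v₃₀ = b₃ , z≤n , λ _ → b₆
      v₃₁ : Valid (3 + j , 1)
      v₃₁ = b₃ , s≤s z≤n , λ ()
      v₂₀ : Valid (2 + j , 0)
      v₂₀ = ≤-trans (n≤1+n _) b₃ , z≤n , λ _ → ≤-trans (n≤1+n _) b₆
      v₂₁ : Valid (2 + j , 1)
      v₂₁ = ≤-trans (n≤1+n _) b₃ , s≤s z≤n , λ ()
      v₂₂ : Valid (2 + j , 2)
      v₂₂ = ≤-trans (n≤1+n _) b₃ , ≤-refl , λ ()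

-- Paths as lists and as indexed families

nth : List ℕ → ℕ → ℕ
-- The value 0 is a default; only indices below the length matter.
nth [] _ = 0
nth (x ∷ xs) zero = x
nth (x ∷ xs) (suc i) = nth xs i

All-nth : ∀ {P : ℕ → Set} {xs} → All P xs → ∀ i → i < length xs → P (nth xs i)
All-nth (p ∷ ps) zero _ = p
All-nth (p ∷ ps) (suc i) (s≤s l) = All-nth ps i l

nth-++ : ∀ xs {y ys} → nth (xs ++ y ∷ ys) (length xs) ≡ y
nth-++ [] = refl
nth-++ (x ∷ xs) = nth-++ xs

nth-++ˡ : ∀ xs {ys} i → i < length xs → nth (xs ++ ys) i ≡ nth xs i
nth-++ˡ (x ∷ xs) zero _ = refl
nth-++ˡ (x ∷ xs) (suc i) (s≤s l) = nth-++ˡ xs i l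

MonoPath⇒InducedPath : ∀ {xs} → MonoPath B c xs → InducedPath B c (nth xs) (length xs)
MonoPath⇒InducedPath π = record { edge = edges π ; far = fars π }
  where
  edges : ∀ {xs} → MonoPath B c xs → ∀ i → suc i < length xs → Edge B c (nth xs i) (nth xs (suc i))
  edges [-] _ (s≤s ())
  edges (cons e _ _) zero _ = e
  edges (cons _ _ π) (suc i) (s≤s l) = edges π i l
  fars : ∀ {xs} → MonoPath B c xs → ∀ i j → suc i < j → j < length xs → NonEdge B (nth xs i) (nth xs j)
  fars (cons _ a π) zero (suc (suc j)) _ (s≤s (s≤s l)) = All-nth a j l
  fars (cons _ a π) (suc i) (suc j) (s≤s l) (s≤s l′) = fars π i j l l′
  fars [-] _ (suc _) _ (s≤s ())
  fars (cons _ _ _) zero (suc zero) (s≤s ()) _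

-- The junction moves along `as`, pushing one vertex at a time onto `bs`; the result runs from the
-- far end of `as` through `x` into `bs`.
MonoPath-splice : ∀ {x} as bs → MonoPath B c (x ∷ as) → MonoPath B c (x ∷ bs) → Separate B as bs →
  MonoPath B c (as ʳ++ x ∷ bs)
MonoPath-splice [] bs π ρ s = ρ
MonoPath-splice {B = B} {x = x} (a ∷ as) bs (cons e n π) ρ (s ∷ ss) = MonoPath-splice as (x ∷ bs) π
  (cons (Edge-sym {B = B} e) s ρ) (All.zipWith (λ (f , t) → NonEdge-sym {B = B} f ∷ t) (n , ss))

MonoPath-reverse : ∀ {xs} → MonoPath B c xs → MonoPath B c (reverse xs)
MonoPath-reverse {xs = []} π = π
MonoPath-reverse {xs = x ∷ xs} π = MonoPath-splice xs [] π [-] (All.universal (λ _ → []) xs)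

MonoPath-snoc : ∀ {s z} xs → MonoPath B c (xs ++ s ∷ []) → Edge B c s z →
  (∀ {y} → y ∈ xs → y ≢ s → NonEdge B y z) → MonoPath B c ((xs ++ s ∷ []) ++ z ∷ [])
MonoPath-snoc [] π e n = cons e [] [-]
MonoPath-snoc (x ∷ []) (cons f _ π) e n = cons f (n (here refl) (proj₁ f) ∷ []) (cons e [] [-])
MonoPath-snoc (x ∷ y ∷ xs) (cons f a π) e n =
  cons f (All.++⁺ a (n (here refl) (proj₁ (All.head (All.++⁻ʳ xs a))) ∷ [])) (MonoPath-snoc (y ∷ xs) π e (n ∘ there))

-- A leg may be longer than required. Vertices are removed at the tip, so the end leading to the
-- centre is kept.
trim : ∀ {P : ℕ → Set} {zs} k ys → k ≤ length ys → All P ys → MonoPath B c (ys ++ zs) →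
  ∃ λ ys′ → length ys′ ≡ k × All P ys′ × MonoPath B c (ys′ ++ zs)
trim k ys l a π with m≤n⇒m<n∨m≡n l
... | inj₂ q = ys , sym q , a , π
trim k (y ∷ ys) l (_ ∷ a) π | inj₁ l′ = trim k ys (≤-pred l′) a (Path-tail π)

-- Arms of the spider

module Arms (t : ℕ) (1≤t : 1 ≤ t) where
  open Leg t 1≤t

  -- Covers every place of the arc, so that one bound serves whichever end succeeds.
  Spoke : ℕ → (ℕ → ℕ) → ℕ → ℕ → Set
  Spoke x g u v = (u ≡ x × ∃ λ k → k ≤ 4 * t × v ≡ g k) ⊎ (v ≡ x × ∃ λ k → k ≤ 4 * t × u ≡ g k)

  -- The third alternative, spokes of the arc's colour to both of its ends, closes a cycle.
  attach : ∀ {x g} → Loopless B → InducedPath B c g (suc (4 * t)) → (∀ k → k ≤ 4 * t → NonEdge B x (g k)) →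
    (∀ {B′} s → s ≡ 0 ⊎ s ≡ 4 * t → Grows (Spoke x g) B B′ → Edge B′ (flip c) x (g s) →
      (∀ {y} → (∀ k → k ≤ s → y ≢ g k) → NonEdge B x y → NonEdge B′ x y) → Game m B′) →
    Game (2 + m) B
  attach {B = B} {c = c} {x = x} {g} ll π n K = join-either c (x≢ 0 z≤n)
    (λ g₁ e₁ → join-either c (x≢ (4 * t) ≤-refl)
      (λ g₂ e₂ → done (path⇒copy {c = c} {g = g} (4 * t) 1≤4t (loopless-grows g₂ (loopless-grows g₁ ll))
        (InducedPath-grows g₂ (off _) (InducedPath-grows g₁ (off _) π)) (Edge-grows g₂ e₁) e₂
        λ k l → NonEdge-grows g₂ (miss (suc k) (4 * t) (<⇒≤ l) (λ q → <-irrefl q l) ≤-refl)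
          (NonEdge-grows g₁ (miss (suc k) 0 (<⇒≤ l) (λ ()) z≤n) (n (suc k) (<⇒≤ l)))))
      (λ g₂ e₂ → K (4 * t) (inj₂ refl) (grows-trans (spoke 0 z≤n g₁) (spoke (4 * t) ≤-refl g₂)) e₂
        λ y# ne → NonEdge-grows g₂ (other (y# (4 * t) ≤-refl)) (NonEdge-grows g₁ (other (y# 0 z≤n)) ne)))
    (λ g₁ e₁ → Wins-mono (n≤1+n _) (K 0 (inj₁ refl) (spoke 0 z≤n g₁) e₁
      λ y# ne → NonEdge-grows g₁ (other (y# 0 z≤n)) ne))
    where
    1≤4t : 1 ≤ 4 * t
    1≤4t = ≤-trans 1≤t (m≤n*m t 4)
    x≢ : ∀ k → k ≤ 4 * t → x ≢ g k
    x≢ k l = proj₁ (n k l)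
    off : ∀ s i j → i < suc (4 * t) → j < suc (4 * t) → ¬ SameEdge x (g s) (g i) (g j)
    off s i j l l′ (inj₁ (q , _)) = x≢ i (≤-pred l) q
    off s i j l l′ (inj₂ (q , _)) = x≢ j (≤-pred l′) q
    g-injective : ∀ i j → i ≤ 4 * t → j ≤ 4 * t → i ≢ j → g i ≢ g j
    g-injective i j l l′ ne q with <-cmp i j
    ... | tri< a _ _ = distinct π i j a (s≤s l′) q
    ... | tri≈ _ a _ = ne a
    ... | tri> _ _ a = distinct π j i a (s≤s l) (sym q)
    miss : ∀ i s → i ≤ 4 * t → i ≢ s → s ≤ 4 * t → ¬ SameEdge x (g s) x (g i)
    miss i s l ne l′ (inj₁ (_ , q)) = g-injective i s l l′ ne (sym q)
    miss i s l ne l′ (inj₂ (q , _)) = x≢ i l q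
    other : ∀ {s y} → y ≢ g s → ¬ SameEdge x (g s) x y
    other y# (inj₁ (_ , q)) = y# (sym q)
    other y# (inj₂ (refl , q)) = y# (sym q)
    spoke : ∀ {B B′} s → s ≤ 4 * t → Grows (SameEdge x (g s)) B B′ → Grows (Spoke x g) B B′
    spoke s l = grows-map λ { (inj₁ (refl , refl)) → inj₁ (refl , s , l , refl) ; (inj₂ (refl , refl)) → inj₂ (refl , s , l , refl) }

  -- A leg needs `M` places and may have to begin at place `4 * t`, the far end of the arc to which
  -- its centre is attached.
  G : ℕ
  G = M + 4 * t

  Region : (ℕ → ℕ) → ℕ → Set
  Region p x = ∃ λ k → k < G × x ≡ p k

  RegionWith : ℕ → (ℕ → ℕ) → ℕ → Set
  RegionWith z p x = x ≡ z ⊎ Region p x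

  record Arm (B : Board) (c : Colour) (z : ℕ) (p : ℕ → ℕ) (x : ℕ) (X : List ℕ) : Set where
    constructor mk-arm
    field
      path : MonoPath B (flip c) (x ∷ X ++ z ∷ [])
      size : suc (length X) ≡ 2 * t
      inside : All (Region p) (x ∷ X)

  private
    4t<M : suc (4 * t) ≤ M
    4t<M = ≤-trans (m≤n+m α (α + (3 * t + 1))) (≤-reflexive (lem t))
      where
      lem : ∀ t → suc (4 * t) + (3 * t + 1) + suc (4 * t) ≡ suc (3 * t + 2 * suc (4 * t))
      lem = solve-∀

  -- Once the centre is attached at place `o`, the leg grows from `o` onwards; the `c`-edge from `z`
  -- to place 0 that occurs when `o` is `4 * t` is thus left behind. The leg is then cut to `2 * t`
  -- vertices.
  build-arm : ∀ {p z} s → suc s ≡ t → Loopless B → InducedPath B c p G → (∀ k → k < G → NonEdge B z (p k)) →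
    (∀ {B′ x X} → Loopless B′ → Grows (λ u v → RegionWith z p u × RegionWith z p v) B B′ → Arm B′ c z p x X → Game m B′) →
    Game (2 + (s * 4 + (2 + m))) B
  build-arm {B = B} {c = c} {m = m} {p = p} {z} s s≡ ll π n K =
    attach ll (InducedPath-shift 0 (suc (4 * t)) (≤-trans 4t<M (m≤m+n M _)) π)
      (λ k l → n k (<-≤-trans (s≤s l) (≤-trans 4t<M (m≤m+n M _))))
      from
    where
    bound : ∀ {o} → o ≡ 0 ⊎ o ≡ 4 * t → o + M ≤ G
    bound (inj₁ refl) = m≤m+n M (4 * t)
    bound (inj₂ refl) = ≤-reflexive (+-comm (4 * t) M)
    z≢ : ∀ k → k < G → z ≢ p k
    z≢ k l = proj₁ (n k l)
    from : ∀ {B₁} o → o ≡ 0 ⊎ o ≡ 4 * t → Grows (Spoke z p) B B₁ → Edge B₁ (flip c) z (p o) →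
      (∀ {y} → (∀ k → k ≤ o → y ≢ p k) → NonEdge B z y → NonEdge B₁ z y) → Game (s * 4 + (2 + m)) B₁
    from {B₁} o o≡ g₁ e₁ n₁ = grow s {xs = []} chorded₀ [-] [] (≤-reflexive (cong (3 *_) s≡)) ([] , refl) to
      where
      inG : ∀ {k} → k < M → o + k < G
      inG l = <-≤-trans (+-monoʳ-< o l) (bound o≡)
      p′ : ℕ → ℕ
      p′ k = p (o + k)
      p-off : ∀ i j → i < G → j < G → ¬ Spoke z p (p i) (p j)
      p-off i j l l′ (inj₁ (q , _)) = z≢ i l (sym q)
      p-off i j l l′ (inj₂ (q , _)) = z≢ j l′ (sym q)
      open Grow {B₀ = B₁} {c = c} p′ (InducedPath-shift o M (bound o≡) (InducedPath-grows g₁ p-off π)) (loopless-grows g₁ ll)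
      open Chorded
      to : ∀ {B₂ ys} → Chorded B₂ → CellPath B₂ ys → All Valid ys → EndsIn (0 , 0) ys →
        2 * suc s + 0 ≤ length ys → Game m B₂
      to {B₂} χ ρ v (ys , refl) l = finish (trim (2 * t) (xs ++ p′ 0 ∷ []) long inside vertices)
        where
        xs : List ℕ
        xs = map (p′ ∘ ν) ys
        split : map (p′ ∘ ν) (ys ++ (0 , 0) ∷ []) ≡ xs ++ p′ 0 ∷ []
        split = map-++ (p′ ∘ ν) ys _
        onPath : All OnPath (xs ++ p′ 0 ∷ [])
        onPath = subst (All OnPath) split (All.map⁺ (All.map (λ {x} v → ν x , ν<M v , refl) v))
        inside : All (Region p) (xs ++ p′ 0 ∷ [])
        inside = All.map (λ { (k , l , q) → o + k , inG l , q }) onPath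
        long : 2 * t ≤ length (xs ++ p′ 0 ∷ [])
        long = ≤-trans (≤-reflexive (trans (cong (2 *_) (sym s≡)) (sym (+-identityʳ _))))
          (≤-trans l (≤-reflexive (trans (sym (length-map (p′ ∘ ν) (ys ++ _))) (cong length split))))
        z-off : ∀ {y} → OnPath z → ¬ OnPath y
        z-off (k , l , q) _ = z≢ _ (inG l) q
        vertices : MonoPath B₂ (flip c) ((xs ++ p′ 0 ∷ []) ++ z ∷ [])
        vertices = MonoPath-snoc xs
          (subst (MonoPath B₂ (flip c)) split (Path-map (p′ ∘ ν) id (Far⇒NonEdge χ) ρ))
          (Edge-sym {B = B₂} (Edge-grows (grown χ) (subst (λ k → Edge B₁ (flip c) z (p k)) (sym (+-identityʳ o)) e₁)))
          λ {y} i y≢ → NonEdge-sym {B = B₂} (NonEdge-grows (grown χ) (λ (a , b) → z-off a b) (off i y≢ (All.lookup (All.++⁻ˡ xs onPath) i)))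
          where
          off : ∀ {y} → y ∈ xs → y ≢ p′ 0 → OnPath y → NonEdge B₁ z y
          off {y} _ y≢ (zero , l , q) = ⊥-elim (y≢ q)
          off {y} _ y≢ (suc k , l , refl) = n₁ (λ k′ l′ q → distinct π k′ (o + suc k) (≤-<-trans l′ (m<m+n o (s≤s z≤n))) (inG l) (sym q)) (n _ (inG l))
        grows-all : Grows (λ u v → RegionWith z p u × RegionWith z p v) B B₂
        grows-all = grows-trans
          (grows-map (λ
            { (inj₁ (q , k , l , r)) → inj₁ q , inj₂ (k , <-≤-trans (s≤s l) (≤-trans 4t<M (m≤m+n M _)) , r)
            ; (inj₂ (q , k , l , r)) → inj₂ (k , <-≤-trans (s≤s l) (≤-trans 4t<M (m≤m+n M _)) , r) , inj₁ q }) g₁)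
          (grows-map (λ { ((k , l , q) , (k′ , l′ , q′)) → inj₂ (o + k , inG l , q) , inj₂ (o + k′ , inG l′ , q′) }) (grown χ))
        finish : (∃ λ ys′ → length ys′ ≡ 2 * t × All (Region p) ys′ × MonoPath B₂ (flip c) (ys′ ++ z ∷ [])) → Game m B₂
        finish ([] , q , _) = ⊥-elim (<-irrefl q (≤-trans 1≤t (m≤m+n t (t + 0))))
        finish (x ∷ X , q , a , ρ) = K (loopless χ) grows-all (mk-arm ρ q a)

  -- The two arms and `z` form a path on `4 * t + 1` vertices, and `y` joined to both tips closes it
  -- to a cycle on one vertex more.
  arms⇒copy : ∀ {d z y a b} A A′ → Loopless B → MonoPath B d (a ∷ A ++ z ∷ []) → MonoPath B d (b ∷ A′ ++ z ∷ []) →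
    Separate B (a ∷ A) (b ∷ A′) → suc (length A) ≡ 2 * t → suc (length A′) ≡ 2 * t →
    Edge B d y a → Edge B d y b → All (NonEdge B y) A → NonEdge B y z → All (NonEdge B y) A′ →
    MonoInducedCopy (Cycle (suc α)) B
  arms⇒copy {B = B} {d} {z} {y} {a} {b} A A′ ll π ρ s l l′ eₐ eᵦ nA nz nA′ = path⇒copy {c = d} {g = nth xs} (4 * t)
    (≤-trans 1≤t (m≤n*m t 4)) ll
    (subst (InducedPath B d (nth xs)) (cong suc (trans (length-++ mid) (trans (+-comm _ 1) size))) (MonoPath⇒InducedPath whole))
    eₐ
    (subst (Edge B d y) (trans (sym (nth-++ (a ∷ mid))) (cong (nth xs) size)) eᵦ)
    λ k q → let q′ = ≤-pred (subst (suc k <_) (sym size) q) in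
      subst (NonEdge B y) (sym (nth-++ˡ mid k q′)) (All-nth avoid k q′)
    where
    mid xs : List ℕ
    mid = A ++ z ∷ reverse A′
    xs = a ∷ mid ++ b ∷ []
    size : suc (length mid) ≡ 4 * t
    size = trans (cong suc (length-++ A)) (trans (cong (λ n → suc (length A + suc n)) (length-reverse A′))
      (trans (cong (suc (length A) +_) l′) (trans (cong (_+ 2 * t) l) (lem t))))
      where
      lem : ∀ t → 2 * t + 2 * t ≡ 4 * t
      lem = solve-∀
    outward : ∀ {x X} → MonoPath B d (x ∷ X ++ z ∷ []) → MonoPath B d (z ∷ reverse (x ∷ X))
    outward {x} {X} π = subst (MonoPath B d) (reverse-++ (x ∷ X) (z ∷ [])) (MonoPath-reverse π)
    ʳ++-all : ∀ {P : ℕ → Set} {X Y} → All P X → All P Y → All P (X ʳ++ Y)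
    ʳ++-all [] q = q
    ʳ++-all (p ∷ ps) q = ʳ++-all ps (p ∷ q)
    reverse-all : ∀ {P : ℕ → Set} {X} → All P X → All P (reverse X)
    reverse-all p = ʳ++-all p []
    whole : MonoPath B d xs
    whole = subst (MonoPath B d)
      (trans (ʳ++-defn (reverse (a ∷ A))) (trans (cong₂ (λ u v → u ++ z ∷ v) (reverse-involutive (a ∷ A)) (unfold-reverse b A′))
        (cong (a ∷_) (sym (++-assoc A (z ∷ reverse A′) (b ∷ []))))))
      (MonoPath-splice (reverse (a ∷ A)) (reverse (b ∷ A′)) (outward π) (outward ρ)
        (reverse-all (All.map reverse-all s)))
    avoid : All (NonEdge B y) mid
    avoid = All.++⁺ nA (nz ∷ reverse-all nA′)

  module Spider {B : Board} {c : Colour} {z a₁ a₂ a₃ : ℕ} {A₁ A₂ A₃ : List ℕ} {g : ℕ → ℕ}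
    (ll : Loopless B) (γ : InducedPath B c g (suc (4 * t)))
    (π₁ : MonoPath B (flip c) (a₁ ∷ A₁ ++ z ∷ [])) (π₂ : MonoPath B (flip c) (a₂ ∷ A₂ ++ z ∷ []))
    (π₃ : MonoPath B (flip c) (a₃ ∷ A₃ ++ z ∷ []))
    (l₁ : suc (length A₁) ≡ 2 * t) (l₂ : suc (length A₂) ≡ 2 * t) (l₃ : suc (length A₃) ≡ 2 * t)
    (s₁₂ : Separate B (a₁ ∷ A₁) (a₂ ∷ A₂)) (s₁₃ : Separate B (a₁ ∷ A₁) (a₃ ∷ A₃)) (s₂₃ : Separate B (a₂ ∷ A₂) (a₃ ∷ A₃))
    (off₁ : ∀ k → k ≤ 4 * t → All (λ x → NonEdge B x (g k)) (a₁ ∷ A₁ ++ z ∷ []))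
    (off₂ : ∀ k → k ≤ 4 * t → All (λ x → NonEdge B x (g k)) (a₂ ∷ A₂ ++ z ∷ []))
    (off₃ : ∀ k → k ≤ 4 * t → All (λ x → NonEdge B x (g k)) (a₃ ∷ A₃ ++ z ∷ [])) where

    OnArc : ℕ → Set
    OnArc x = ∃ λ k → k ≤ 4 * t × x ≡ g k

    Tip : ℕ → Set
    Tip x = x ≡ a₁ ⊎ x ≡ a₂ ⊎ x ≡ a₃

    Spokes : ℕ → ℕ → Set
    Spokes u v = (Tip u × OnArc v) ⊎ (OnArc u × Tip v)

    -- `plain` keeps tips out of the interior of an arm, so that no spoke touches it.
    record Ready (a : ℕ) (A : List ℕ) : Set where
      constructor ready
      field
        path : MonoPath B (flip c) (a ∷ A ++ z ∷ [])
        size : suc (length A) ≡ 2 * t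
        off : ∀ k → k ≤ 4 * t → All (λ x → NonEdge B x (g k)) (a ∷ A ++ z ∷ [])
        plain : All (¬_ ∘ Tip) A

    private
      ≢-tip : ∀ {a A} → MonoPath B (flip c) (a ∷ A ++ z ∷ []) → a ≢ z × All (a ≢_) A
      ≢-tip {A = A} π = let q = MonoPath-distinct π in All.head (All.++⁻ʳ A q) , All.++⁻ˡ A q

      col : ∀ {b X Y} → Separate B X (b ∷ Y) → All (_≢ b) X
      col = All.map (proj₁ ∘ All.head)

      row : ∀ {b X Y} → Separate B (b ∷ X) Y → All (_≢ b) Y
      row (s ∷ _) = All.map (≢-sym ∘ proj₁) s

      none : ∀ {X} → All (_≢ a₁) X → All (_≢ a₂) X → All (_≢ a₃) X → All (¬_ ∘ Tip) X
      none [] [] [] = []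
      none (p ∷ ps) (q ∷ qs) (r ∷ rs) = [ p , [ q , r ]′ ]′ ∷ none ps qs rs

      ready₁ : Ready a₁ A₁
      ready₁ = ready π₁ l₁ off₁
        (none (All.map ≢-sym (proj₂ (≢-tip π₁))) (All.tail (col s₁₂)) (All.tail (col s₁₃)))

      ready₂ : Ready a₂ A₂
      ready₂ = ready π₂ l₂ off₂
        (none (All.tail (row s₁₂)) (All.map ≢-sym (proj₂ (≢-tip π₂))) (All.tail (col s₂₃)))

      ready₃ : Ready a₃ A₃
      ready₃ = ready π₃ l₃ off₃
        (none (All.tail (row s₁₃)) (All.tail (row s₂₃)) (All.map ≢-sym (proj₂ (≢-tip π₃))))

      z-plain : ¬ Tip z
      z-plain = [ ≢-sym (proj₁ (≢-tip π₁)) , [ ≢-sym (proj₁ (≢-tip π₂)) , ≢-sym (proj₁ (≢-tip π₃)) ]′ ]′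

      off-arc : ∀ {X} → (∀ k → k ≤ 4 * t → All (λ x → NonEdge B x (g k)) X) → ∀ {x} → x ∈ X → ¬ OnArc x
      off-arc o i (k , l , q) = proj₁ (All.lookup (o k l) i) q

      arc-tip : ∀ {x} → OnArc x → ¬ Tip x
      arc-tip (k , l , q) (inj₁ refl) = proj₁ (All.head (off₁ k l)) q
      arc-tip (k , l , q) (inj₂ (inj₁ refl)) = proj₁ (All.head (off₂ k l)) q
      arc-tip (k , l , q) (inj₂ (inj₂ refl)) = proj₁ (All.head (off₃ k l)) q

    close : ∀ {B′ a b A A′ s} → Ready a A → Ready b A′ → Separate B (a ∷ A) (b ∷ A′) → Grows Spokes B B′ → s ≤ 4 * t →
      Edge B′ (flip c) a (g s) → Edge B′ (flip c) b (g s) → MonoInducedCopy (Cycle (suc α)) B′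
    close {B′} {a} {b} {A} {A′} {s} (ready π l o pl) (ready π′ l′ o′ pl′) sep h s≤ e e′ =
      arms⇒copy A A′ (loopless-grows h ll) (grown π o) (grown π′ o′) sep′ l l′ (Edge-sym {B = B′} e) (Edge-sym {B = B′} e′)
        (spread pl (All.++⁻ˡ A (All.tail (o s s≤)))) (All.head (spread (z-plain ∷ []) (All.++⁻ʳ A (All.tail (o s s≤)))))
        (spread pl′ (All.++⁻ˡ A′ (All.tail (o′ s s≤))))
      where
      grown : ∀ {X} → MonoPath B (flip c) X → (∀ k → k ≤ 4 * t → All (λ x → NonEdge B x (g k)) X) → MonoPath B′ (flip c) X
      grown π o = Path-map∈ (Edge-grows h) (λ i j → NonEdge-grows h λ
        { (inj₁ (_ , v)) → off-arc o j v ; (inj₂ (u , _)) → off-arc o i u }) π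
      arm-off : ∀ {X y} → (∀ k → k ≤ 4 * t → All (λ x → NonEdge B x (g k)) (X ++ z ∷ [])) → y ∈ X → ¬ OnArc y
      arm-off {X} o i = off-arc (λ k q → All.++⁻ˡ X (o k q)) i
      sep′ : Separate B′ (a ∷ A) (b ∷ A′)
      sep′ = All.tabulate λ i → All.tabulate λ j → NonEdge-grows h
        (λ { (inj₁ (_ , v)) → arm-off {b ∷ A′} o′ j v ; (inj₂ (u , _)) → arm-off {a ∷ A} o i u })
        (All.lookup (All.lookup sep i) j)
      spread : ∀ {X} → All (¬_ ∘ Tip) X → All (λ x → NonEdge B x (g s)) X → All (NonEdge B′ (g s)) X
      spread [] [] = []
      spread (p ∷ ps) (n ∷ ns) = NonEdge-grows h
        (λ { (inj₁ (u , _)) → arc-tip (s , s≤ , refl) u ; (inj₂ (_ , v)) → p v }) (NonEdge-sym {B = B} n) ∷ spread ps ns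

    -- Three attachments of at most 2 rounds each; by the pigeonhole principle two of the tips share
    -- an end, which `pick` spells out.
    win : Game 6 B
    win = attach ll γ (λ k l → All.head (off₁ k l)) λ s₁ q₁ h₁ e₁ _ →
      attach (loopless-grows h₁ ll) (InducedPath-grows h₁ (off-path off₁) γ)
        (λ k l → NonEdge-grows h₁ (off-tip off₁ (All.head (row s₁₂)) k l) (All.head (off₂ k l))) λ s₂ q₂ h₂ e₂ _ →
      attach (loopless-grows h₂ (loopless-grows h₁ ll))
        (InducedPath-grows h₂ (off-path off₂) (InducedPath-grows h₁ (off-path off₁) γ))
        (λ k l → NonEdge-grows h₂ (off-tip off₂ (All.head (row s₂₃)) k l)
          (NonEdge-grows h₁ (off-tip off₁ (All.head (row s₁₃)) k l) (All.head (off₃ k l)))) λ s₃ q₃ h₃ e₃ _ →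
      done (pick (grows-trans (spokes (inj₁ refl) h₁) (grows-trans (spokes (inj₂ (inj₁ refl)) h₂) (spokes (inj₂ (inj₂ refl)) h₃)))
        q₁ q₂ q₃ (Edge-grows h₃ (Edge-grows h₂ e₁)) (Edge-grows h₃ e₂) e₃)
      where
      off-path : ∀ {a X} → (∀ k → k ≤ 4 * t → All (λ x → NonEdge B x (g k)) (a ∷ X)) →
        ∀ i j → i < suc (4 * t) → j < suc (4 * t) → ¬ Spoke a g (g i) (g j)
      off-path o i j l l′ (inj₁ (q , _)) = proj₁ (All.head (o i (≤-pred l))) (sym q)
      off-path o i j l l′ (inj₂ (q , _)) = proj₁ (All.head (o j (≤-pred l′))) (sym q)
      off-tip : ∀ {a b X} → (∀ k → k ≤ 4 * t → All (λ x → NonEdge B x (g k)) (a ∷ X)) → b ≢ a →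
        ∀ k → k ≤ 4 * t → ¬ Spoke a g b (g k)
      off-tip o n k l (inj₁ (q , _)) = n q
      off-tip o n k l (inj₂ (q , _)) = proj₁ (All.head (o k l)) (sym q)
      spokes : ∀ {a B B′} → Tip a → Grows (Spoke a g) B B′ → Grows Spokes B B′
      spokes τ = grows-map λ { (inj₁ (refl , v)) → inj₁ (τ , v) ; (inj₂ (refl , u)) → inj₂ (u , τ) }
      pick : ∀ {B′ s₁ s₂ s₃} → Grows Spokes B B′ → s₁ ≡ 0 ⊎ s₁ ≡ 4 * t → s₂ ≡ 0 ⊎ s₂ ≡ 4 * t → s₃ ≡ 0 ⊎ s₃ ≡ 4 * t →
        Edge B′ (flip c) a₁ (g s₁) → Edge B′ (flip c) a₂ (g s₂) → Edge B′ (flip c) a₃ (g s₃) →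
        MonoInducedCopy (Cycle (suc α)) B′
      pick h (inj₁ refl) (inj₁ refl) _ e₁ e₂ _ = close ready₁ ready₂ s₁₂ h z≤n e₁ e₂
      pick h (inj₂ refl) (inj₂ refl) _ e₁ e₂ _ = close ready₁ ready₂ s₁₂ h ≤-refl e₁ e₂
      pick h (inj₁ refl) (inj₂ refl) (inj₁ refl) e₁ _ e₃ = close ready₁ ready₃ s₁₃ h z≤n e₁ e₃
      pick h (inj₁ refl) (inj₂ refl) (inj₂ refl) _ e₂ e₃ = close ready₂ ready₃ s₂₃ h ≤-refl e₂ e₃
      pick h (inj₂ refl) (inj₁ refl) (inj₁ refl) _ e₂ e₃ = close ready₂ ready₃ s₂₃ h z≤n e₂ e₃
      pick h (inj₂ refl) (inj₁ refl) (inj₂ refl) e₁ _ e₃ = close ready₁ ready₃ s₁₃ h ≤-refl e₁ e₃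

-- Assembling the even cycle

module EvenCycle (s : ℕ) where
  private
    t : ℕ
    t = suc s
    1≤t : 1 ≤ t
    1≤t = s≤s z≤n

  open Leg t 1≤t
  open Arms t 1≤t

  -- Place 0 is the centre. One free place follows it and one follows each region of `G` places,
  -- which makes the regions pairwise non-adjacent. Regions 0 to 2 receive the arms, region 3
  -- provides the arc.
  offset : ℕ → ℕ
  offset j = 2 + j * suc G

  L : ℕ
  L = offset 4

  module Board₀ {B₀ : Board} {c : Colour} (p : ℕ → ℕ) (π : InducedPath B₀ c p L) (ll₀ : Loopless B₀) where
    z : ℕ
    z = p 0

    q : ℕ → ℕ → ℕ
    q j k = p (offset j + k)

    private
      next : ∀ {j k} → k < G → suc (offset j + k) < offset (suc j)
      next {j} {k} l = ≤-by 0 l (lem (j * suc G) k G)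
        where
        lem : ∀ a k g → 2 + (suc g + a) + suc k ≡ suc (suc (2 + a + k)) + 0 + g
        lem = solve-∀

      offset-mono : ∀ {i j} → i ≤ j → offset i ≤ offset j
      offset-mono l = s≤s (s≤s (*-monoˡ-≤ (suc G) l))

      inL : ∀ {j k} → j < 4 → k < G → offset j + k < L
      inL {j} l l′ = <-≤-trans (<-trans (n<1+n _) (next {j} l′)) (offset-mono l)

      ordered : ∀ {i j x y} → i < j → j < 4 → Region (q i) x → Region (q j) y → NonEdge B₀ x y
      ordered {i} {j} l l′ (k , b , refl) (k′ , b′ , refl) =
        far π _ _ (<-≤-trans (next {i} b) (≤-trans (offset-mono l) (m≤m+n (offset j) k′))) (inL {j} l′ b′)

    across : ∀ {i j x y} → i < 4 → j < 4 → i ≢ j → Region (q i) x → Region (q j) y → NonEdge B₀ x y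
    across {i} {j} l l′ n u v with <-cmp i j
    ... | tri< a _ _ = ordered a l′ u v
    ... | tri≈ _ a _ = ⊥-elim (n a)
    ... | tri> _ _ a = NonEdge-sym {B = B₀} (ordered a l v u)

    centre : ∀ {j y} → j < 4 → Region (q j) y → NonEdge B₀ z y
    centre {j} l (k , b , refl) = far π 0 (offset j + k) (s≤s (s≤s z≤n)) (inL {j} l b)

    Zone : ℕ → ℕ → Set
    Zone j = RegionWith z (q j)

    zone-region : ∀ {i j x} → i < 4 → j < 4 → i ≢ j → Region (q i) x → ¬ Zone j x
    zone-region l l′ n u (inj₁ refl) = proj₁ (centre l u) refl
    zone-region l l′ n u (inj₂ v) = proj₁ (across l l′ n u v) refl

    -- The first n regions have received their arms.
    record World (n : ℕ) (B : Board) : Set where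
      field
        kept : ∀ {d x y} → AdjC B₀ d x y → AdjC B d x y
        cross : ∀ {i j x y} → i < 4 → j < 4 → i ≢ j → Region (q i) x → Region (q j) y → ¬ Adj B x y
        untouched : ∀ {j x y} → n ≤ j → j < 4 → Region (q j) x → Adj B x y → Adj B₀ x y
        loopless : Loopless B
    open World

    world₀ : World 0 B₀
    world₀ = record { kept = id ; cross = λ l l′ n u v → proj₂ (across l l′ n u v) ; untouched = λ _ _ _ a → a ; loopless = ll₀ }

    -- New edges run only among the centre and region `n`. Of two different regions one is not
    -- region `n`, so no new edge joins them.
    world-grows : ∀ {n B B′} → n < 4 → Grows (λ u v → Zone n u × Zone n v) B B′ → World n B → World (suc n) B′
    world-grows {n} b g w = record
      { kept = keep g ∘ kept w
      ; cross = λ {i} {j} l l′ i≢j u v → [ cross w l l′ i≢j u v , (λ (u′ , v′) → meet l l′ i≢j u v u′ v′) ]′ ∘ new g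
      ; untouched = λ {j} l l′ u → [ untouched w (<⇒≤ l) l′ u ,
          (λ (u′ , _) → ⊥-elim (zone-region l′ b (≢-sym (<⇒≢ l)) u u′)) ]′ ∘ new g
      ; loopless = loopless-grows g (loopless w) }
      where
      meet : ∀ {i j x y} → i < 4 → j < 4 → i ≢ j → Region (q i) x → Region (q j) y → Zone n x → Zone n y → ⊥
      meet {i} l l′ i≢j u v u′ v′ with i ≟ n
      ... | yes refl = zone-region l′ b (≢-sym i≢j) v v′
      ... | no i≢n = zone-region l b i≢n u u′

    region-path : ∀ {n j B} → World n B → n ≤ j → j < 4 → InducedPath B c (q j) G
    region-path {j = j} {B} w l b = record
      { edge = λ i b′ → proj₁ (edge π′ i b′) , kept w (proj₂ (edge π′ i b′))
      ; far = λ i k b₁ b₂ → proj₁ (far π′ i k b₁ b₂) ,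
          proj₂ (far π′ i k b₁ b₂) ∘ untouched w l b (i , <-trans (<-trans (n<1+n i) b₁) b₂ , refl) }
      where
      π′ : InducedPath B₀ c (q j) G
      π′ = InducedPath-shift (offset j) G (≤-trans (≤-by 1 (z≤n {0}) (lem (j * suc G) G)) (offset-mono b)) π
        where
        lem : ∀ a g → 2 + (suc g + a) + 0 ≡ 2 + a + g + 1 + 0
        lem = solve-∀

    centre-off : ∀ {n j B} → World n B → n ≤ j → j < 4 → ∀ k → k < G → NonEdge B z (q j k)
    centre-off w l b k b′ = let r = (k , b′ , refl) in
      proj₁ (centre b r) , λ a → proj₂ (centre b r) (Adj-sym (untouched w l b r (Adj-sym a)))

    -- An arm in another region meets zone `n` only in `z`, and the two vertices of a non-edge are
    -- distinct, so they cannot both be `z`.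
    arm-grows : ∀ {i n B B′ x X} → i < 4 → n < 4 → i ≢ n → Grows (λ u v → Zone n u × Zone n v) B B′ →
      Arm B c z (q i) x X → Arm B′ c z (q i) x X
    arm-grows {i} {n} {x = x} {X} l l′ i≢n g (mk-arm ρ k ins) = mk-arm (Path-map∈ (Edge-grows g)
      (λ a b ne → NonEdge-grows g (λ (u , v) → proj₁ ne (trans (is-z a u) (sym (is-z b v)))) ne) ρ) k ins
      where
      is-z : ∀ {y} → y ∈ x ∷ X ++ z ∷ [] → Zone n y → y ≡ z
      is-z a u with All.lookup (All.++⁺ {P = λ y → y ≡ z ⊎ Region (q i) y} (All.map inj₂ ins) (inj₁ refl ∷ [])) a
      ... | inj₁ r = r
      ... | inj₂ r = ⊥-elim (zone-region l l′ i≢n r u)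

    arm-step : ∀ {n B m} → n < 4 → World n B →
      (∀ {B′ x X} → World (suc n) B′ → Grows (λ u v → Zone n u × Zone n v) B B′ → Arm B′ c z (q n) x X → Game m B′) →
      Game (2 + (s * 4 + (2 + m))) B
    arm-step b w K = build-arm s refl (loopless w) (region-path w ≤-refl b) (centre-off w ≤-refl b)
      λ _ g a → K (world-grows b g w) g a

    win : Game (2 + (s * 4 + (2 + (2 + (s * 4 + (2 + (2 + (s * 4 + (2 + 6))))))))) B₀
    win = arm-step b₀ world₀ λ w₁ g₁ a₁ → arm-step b₁ w₁ λ w₂ g₂ a₂ → arm-step b₂ w₂ λ w₃ g₃ a₃ →
      let a₁′ = arm-grows b₀ b₂ (λ ()) g₃ (arm-grows b₀ b₁ (λ ()) g₂ a₁)
          a₂′ = arm-grows b₁ b₂ (λ ()) g₃ a₂ in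
      Spider.win (loopless w₃) (InducedPath-shift 0 (suc (4 * t)) arc≤G (region-path w₃ ≤-refl b₃))
        (path a₁′) (path a₂′) (path a₃) (size a₁′) (size a₂′) (size a₃)
        (separate w₃ b₀ b₁ (λ ()) a₁′ a₂′) (separate w₃ b₀ b₂ (λ ()) a₁′ a₃) (separate w₃ b₁ b₂ (λ ()) a₂′ a₃)
        (off w₃ b₀ (λ ()) a₁′) (off w₃ b₁ (λ ()) a₂′) (off w₃ b₂ (λ ()) a₃)
      where
      open Arm
      b₀ : 0 < 4
      b₀ = s≤s z≤n
      b₁ : 1 < 4
      b₁ = s≤s (s≤s z≤n)
      b₂ : 2 < 4
      b₂ = s≤s (s≤s (s≤s z≤n))
      b₃ : 3 < 4
      b₃ = ≤-refl
      arc≤G : suc (4 * t) ≤ G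
      arc≤G = s≤s (m≤n+m (4 * t) (3 * t + 2 * α))
      separate : ∀ {i j B x y X Y} → World 3 B → i < 4 → j < 4 → i ≢ j → Arm B c z (q i) x X → Arm B c z (q j) y Y →
        Separate B (x ∷ X) (y ∷ Y)
      separate w l l′ n a a′ = All.map (λ u → All.map (λ v → proj₁ (across l l′ n u v) , cross w l l′ n u v) (inside a′)) (inside a)
      off : ∀ {i B x X} → World 3 B → i < 4 → i ≢ 3 → Arm B c z (q i) x X →
        ∀ k → k ≤ 4 * t → All (λ x → NonEdge B x (q 3 k)) (x ∷ X ++ z ∷ [])
      off w l n a k l′ = All.++⁺ (All.map (λ u → proj₁ (across l b₃ n u r) , cross w l b₃ n u r) (inside a))
        (centre-off w ≤-refl b₃ k k<G ∷ [])
        where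
        k<G = ≤-trans (s≤s l′) arc≤G
        r = (k , k<G , refl)

  -- 2 n₀ = 9 L
  n₀ rounds : ℕ
  n₀ = 270 * t + 81
  rounds = n₀ + n₀ + (n₀ * 3 + (2 + (s * 4 + (2 + (2 + (s * 4 + (2 + (2 + (s * 4 + (2 + 6))))))))))

  even-cycle : Game rounds []
  even-cycle = long-path L n₀ (≤-reflexive (lem t)) λ {B} {c} {X} ll ρ l →
    Board₀.win (nth X) (InducedPath-shift 0 L l (MonoPath⇒InducedPath ρ)) ll
    where
    lem : ∀ t → 9 * (2 + 4 * suc (suc (3 * t + 2 * suc (4 * t)) + 4 * t)) ≡ 2 * (270 * t + 81)
    lem = solve-∀

theorem4 : (n : ℕ) → Odd n → 3 ≤ n →
    ((m : ℕ) → IndOnlineRamseyLE (Cycle (2 * n)) m → IndOnlineRamseyLE (Cycle n) (m + n))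
    × (∃ λ m → IndOnlineRamseyLE (Cycle (2 * n)) m × m + n ≤ 735 * n ∸ 27)
theorem4 _ (zero , refl) (s≤s ())
theorem4 _ (suc s , refl) _ = (λ m → halve-cycle (suc s) (s≤s z≤n) (lem (suc s))) ,
  rounds , subst (λ N → Wins (Cycle N) rounds []) (sym (lem (suc s))) even-cycle ,
  -- With t = `suc s`, the left side is 1364t + 412 and 735n - 27 is 1470t + 708; the difference
  -- 106t + 296 is `106 * s + 402`. Adding 27 turns the truncated subtraction into a polynomial
  -- identity.
  ≤-trans (m≤m+n _ (106 * s + 402)) (≤-reflexive (trans (sym (m+n∸n≡m _ 27)) (cong (_∸ 27) (count s))))
  where
  open EvenCycle s
  lem : ∀ t → 2 * suc (2 * t) ≡ 2 + 4 * t
  lem = solve-∀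
  count : ∀ s → (270 * suc s + 81 + (270 * suc s + 81) + ((270 * suc s + 81) * 3 +
    (2 + (s * 4 + (2 + (2 + (s * 4 + (2 + (2 + (s * 4 + (2 + 6)))))))))) + suc (2 * suc s)) + (106 * s + 402) + 27
    ≡ 735 * suc (2 * suc s)
  count = solve-∀
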